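{- Let $G$ be a connected bipartite cubic graph. Then $\gamma(G) \leq \frac{120}{49}\rho(G) < 2.45\,\rho(G)$.
   Context: All graphs are finite and simple. A graph is cubic if every vertex has degree exactly $3$. A dominating set of $G$ is a set $X \subseteq V(G)$ such that every vertex of $V(G)\setminus X$ has a neighbor in $X$; $\gamma(G)$ is the minimum size of a dominating set. A packing of $G$ is a set $Y \subseteq V(G)$ such that $N_G[u] \cap N_G[v] = \emptyset$ for all distinct $u,v \in Y$ (equivalently, pairwise distance at least $3$), where $N_G[v]=N_G(v)\cup\{v\}$; $\rho(G)$ is the maximum size of a packing. -}

module Defs where

open import Data.Nat using (ℕ; zero; suc; _+_; _*_; _≤_; _<_)
open import Data.Bool using (Bool; true; false; T; not)
open import Data.Fin using (Fin)
open import Data.Fin.Subset using (Subset; _∈_; ∣_∣)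
open import Data.List using (List; filter; length; allFin)
open import Data.Product using (Σ; ∃; _×_; _,_)
open import Data.Sum using (_⊎_)
open import Data.Empty using (⊥)
open import Relation.Nullary using (¬_)
open import Relation.Binary.PropositionalEquality using (_≡_; _≢_)
open import Relation.Nullary.Decidable using (does)
open import Data.Bool using (_≟_)

record Graph (n : ℕ) : Set where
  field
    adj     : Fin n → Fin n → Bool
    adj-sym : ∀ u v → adj u v ≡ adj v u
    adj-irr : ∀ v → adj v v ≡ false
open Graph public

Adj : ∀ {n} → Graph n → Fin n → Fin n → Set
Adj G u v = T (adj G u v)

degree : ∀ {n} → Graph n → Fin n → ℕ
degree {n} G v = length (filter (λ u → T? (adj G v u)) (allFin n))
  where
  open import Data.Bool.Properties using (T?)

Cubic : ∀ {n} → Graph n → Set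
Cubic {n} G = ∀ (v : Fin n) → degree G v ≡ 3

data Reach {n} (G : Graph n) : Fin n → Fin n → Set where
  here : ∀ {v} → Reach G v v
  step : ∀ {u v w} → Adj G u v → Reach G v w → Reach G u w

Connected : ∀ {n} → Graph n → Set
Connected {n} G = ∀ (u v : Fin n) → Reach G u v

Bipartite : ∀ {n} → Graph n → Set
Bipartite {n} G = Σ (Fin n → Bool) λ c → ∀ u v → Adj G u v → c u ≢ c v

InClosedNbhd : ∀ {n} → Graph n → Fin n → Fin n → Set
InClosedNbhd G v w = w ≡ v ⊎ Adj G v w

Dominating : ∀ {n} → Graph n → Subset n → Set
Dominating {n} G X = ∀ (v : Fin n) → v ∈ X ⊎ ∃ λ u → u ∈ X × Adj G u v

Packing : ∀ {n} → Graph n → Subset n → Set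
Packing {n} G Y = ∀ (u v : Fin n) → u ∈ Y → v ∈ Y → u ≢ v →
  ∀ (w : Fin n) → ¬ (InClosedNbhd G u w × InClosedNbhd G v w)

-- γ(G) ≤ k  iff some dominating set has size ≤ k; k ≤ ρ(G) iff some packing
-- has size ≥ k. We avoid defining γ, ρ as functions and characterise them:
IsMinDominating : ∀ {n} → Graph n → Subset n → Set
IsMinDominating {n} G X = Dominating G X × (∀ X' → Dominating G X' → ∣ X ∣ ≤ ∣ X' ∣)

IsMaxPacking : ∀ {n} → Graph n → Subset n → Set
IsMaxPacking {n} G Y = Packing G Y × (∀ Y' → Packing G Y' → ∣ Y' ∣ ≤ ∣ Y ∣)

{-# OPTIONS --safe #-}
-- The bound obtained is 5 γ ≤ 12 ρ.
-- Let A, B be the colour classes, S ⊆ A a maximal packing, Q = N(S) and R = B ∖ Q. By maximality every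
-- vertex of A ∖ S has a neighbour in Q, so at most two in R; the graph on R joining vertices with a
-- common neighbour is therefore subcubic. Brooks' theorem, with K₄ components treated separately, gives
-- a packing I ⊆ R and a set D dominating R ∪ N(R) with |D| ≤ |R| and |D| ≤ 3 |I|. The part A₀ of A ∖ S
-- without neighbours in R is dominated greedily: M ⊆ Q is a maximal set of vertices with two neighbours
-- in A₀, no two sharing one, and U is what M leaves undominated in A₀. Then S ∪ I is a packing and
-- S ∪ D ∪ M ∪ U is dominating; counting edges gives |Q| ≤ 3 |S|, |R| + 2 |S| + 2 |A₀| ≤ 2 |Q|,
-- 3 |U| + |M| ≤ |Q| and |U| + 2 |M| ≤ |A₀|, whose combination is the claim.
module Submission where

open import Defs
open import Data.Nat using (ℕ; _*_; _≤_; _<_)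
open import Data.Fin.Subset using (Subset; ∣_∣)
open import Data.Product using (_×_)
open import Data.Bool using (Bool; true; false; T; if_then_else_; _≟_)
open import Data.Bool.Properties using (T?)
open import Data.Nat using (zero; suc; _+_; z≤n; s≤s; _<?_; >-nonZero)
open import Data.Nat.Properties hiding (_≟_; 0≢1+n; suc-injective)
open import Data.Nat.Solver using (module +-*-Solver)
open import Data.Fin using (Fin; zero; suc)
open import Data.Fin.Properties using (any?; all?; pigeonhole; 0≢1+n; suc-injective) renaming (_≟_ to _≟ᶠ_)
open import Data.Fin.Subset using (_∈_; _∉_; _⊆_; ⁅_⁆; _∪_; ⊥; ⊤; inside; outside)
open import Data.Fin.Subset.Properties
open import Data.List using (List; []; _∷_; length; filter; allFin; lookup)
import Data.List as List
open import Data.List.Membership.Propositional using () renaming (_∈_ to _∈ₗ_)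
open import Data.List.Membership.Propositional.Properties using (∈-filter⁺; ∈-allFin)
open import Data.List.Membership.DecPropositional using () renaming (_∈?_ to mem?)
open import Data.List.Relation.Unary.Any using (here; there; index)
open import Data.List.Relation.Unary.Any.Properties using (lookup-index)
open import Data.Vec using ([]; _∷_; tabulate)
import Data.Vec as Vec
open import Data.Vec.Properties using (lookup∘tabulate; []=⇒lookup; lookup⇒[]=)
open import Data.Product using (Σ; ∃; _,_; proj₁; proj₂)
open import Data.Sum using (_⊎_; inj₁; inj₂; [_,_]′)
open import Data.Empty using (⊥-elim)
open import Function using (_∘_)
open import Relation.Nullary using (¬_; Dec; yes; no; does; contradiction; ¬?)
open import Relation.Nullary.Decidable using (_×-dec_; _⊎-dec_; _→-dec_; dec-true; dec-false)
open import Relation.Binary.PropositionalEquality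
  using (_≡_; _≢_; refl; sym; trans; cong; cong₂; subst; module ≡-Reasoning)
open import Algebra.Properties.Semiring.Sum +-*-semiring
  using (sum; sum-cong-≗; ∑-distrib-+; ∑-comm; *-distribˡ-sum)

-- The bound |D| ≤ 3 |I| alone is too weak, since 3 exceeds 12/5. The second bound |D| ≤ |R| helps
-- because |Q| limits |R|: a vertex of A sends at most twice as many edges to R as to Q, and the
-- vertices of S and A₀ send all three to Q. A large A₀, which is costly to dominate, therefore
-- forces a small R. Packings of the two colour classes can be joined here because closed
-- neighbourhoods of vertices of opposite colour meet only along an edge, and R has no edge to S =
-- N-free side of Q's complement. A K₄ of conflicts violates |R| ≤ 3 |I|, having four vertices and
-- independence number one; what survives is the bound on the dominating set, because its four
-- vertices and all their neighbours need only three dominators. The constant 12/5 is the best that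
-- the six inequalities allow: |S| = 3, |D| = |R| = 6, |I| = 2, |Q| = 9, |A₀| = 3, |M| = 0, |U| = 3
-- makes all of them equalities. It lies below 120/49, which leaves room for both stated bounds.

private
  pattern 1st = here refl
  pattern 2nd = there 1st
  pattern 3rd = there 2nd
  pattern 4th = there 3rd
  pattern 5th = there 4th
  pattern 6th = there 5th

-- Counting

⟦_⟧ : {P : Set} → Dec P → ℕ
⟦ d ⟧ = if does d then 1 else 0

⟦⟧-yes : {P : Set} (d : Dec P) → P → ⟦ d ⟧ ≡ 1
⟦⟧-yes d p rewrite dec-true d p = refl

⟦⟧-no : {P : Set} (d : Dec P) → ¬ P → ⟦ d ⟧ ≡ 0
⟦⟧-no d ¬p rewrite dec-false d ¬p = refl

⟦⟧-cong : {P Q : Set} (d : Dec P) (e : Dec Q) → (P → Q) → (Q → P) → ⟦ d ⟧ ≡ ⟦ e ⟧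
⟦⟧-cong (yes p) e f g = sym (⟦⟧-yes e (f p))
⟦⟧-cong (no ¬p) e f g = sym (⟦⟧-no e (¬p ∘ g))

sum-mono : ∀ {n} {f g : Fin n → ℕ} → (∀ i → f i ≤ g i) → sum f ≤ sum g
sum-mono {zero} f≤g = z≤n
sum-mono {suc n} f≤g = +-mono-≤ (f≤g zero) (sum-mono (f≤g ∘ suc))

term≤sum : ∀ {n} (f : Fin n → ℕ) i → f i ≤ sum f
term≤sum f zero = m≤m+n _ _
term≤sum f (suc i) = ≤-trans (term≤sum (f ∘ suc) i) (m≤n+m _ _)

two-terms≤sum : ∀ {n} (f : Fin n → ℕ) {i j} → i ≢ j → f i + f j ≤ sum f
two-terms≤sum f {zero} {zero} i≢j = contradiction refl i≢j
two-terms≤sum f {zero} {suc j} _ = +-monoʳ-≤ (f zero) (term≤sum (f ∘ suc) j)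
two-terms≤sum f {suc i} {zero} _ =
  subst (_≤ sum f) (+-comm (f zero) _) (+-monoʳ-≤ (f zero) (term≤sum (f ∘ suc) i))
two-terms≤sum f {suc i} {suc j} i≢j =
  ≤-trans (two-terms≤sum (f ∘ suc) (i≢j ∘ cong suc)) (m≤n+m _ _)

sum-zero : ∀ {n} {f : Fin n → ℕ} → (∀ i → f i ≡ 0) → sum f ≡ 0
sum-zero {zero} f≡0 = refl
sum-zero {suc n} f≡0 rewrite f≡0 zero = sum-zero (f≡0 ∘ suc)

sum-unique≤1 : ∀ {n} {P : Fin n → Set} (P? : ∀ i → Dec (P i)) →
  (∀ {i j} → P i → P j → i ≡ j) → sum (λ i → ⟦ P? i ⟧) ≤ 1
sum-unique≤1 {zero} P? unique = z≤n
sum-unique≤1 {suc n} P? unique with P? zero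
... | yes p = ≤-reflexive (cong suc (sum-zero λ i → ⟦⟧-no (P? (suc i)) λ q → 0≢1+n (unique p q)))
... | no _ = sum-unique≤1 (P? ∘ suc) λ p q → suc-injective (unique p q)

-- Discharging: `h i j` is the amount that `i` sends to `j`; at least `f i` leaves each `i` and at
-- most `g j` reaches each `j`.
double-count : ∀ {m n} (h : Fin m → Fin n → ℕ) {f : Fin m → ℕ} {g : Fin n → ℕ} →
  (∀ i → f i ≤ sum (h i)) → (∀ j → sum (λ i → h i j) ≤ g j) → sum f ≤ sum g
double-count h {f} {g} rows columns = begin
  sum f                          ≤⟨ sum-mono rows ⟩
  sum (λ i → sum (h i))          ≡⟨ ∑-comm h ⟩
  sum (λ j → sum (λ i → h i j))  ≤⟨ sum-mono columns ⟩
  sum g                          ∎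
  where open ≤-Reasoning

length-filter : ∀ {A : Set} {P : A → Set} (P? : ∀ x → Dec (P x)) {n} (f : Fin n → A) →
  length (filter P? (List.tabulate f)) ≡ sum (λ i → ⟦ P? (f i) ⟧)
length-filter P? {zero} f = refl
length-filter P? {suc n} f with P? (f zero)
... | yes _ = cong suc (length-filter P? (f ∘ suc))
... | no _ = length-filter P? (f ∘ suc)

∣∣≡sum : ∀ {n} (p : Subset n) → ∣ p ∣ ≡ sum (λ v → ⟦ v ∈? p ⟧)
∣∣≡sum [] = refl
∣∣≡sum (inside ∷ p) = cong suc (∣∣≡sum p)
∣∣≡sum (outside ∷ p) = ∣∣≡sum p

*∣∣≡sum : ∀ {n} k (p : Subset n) → k * ∣ p ∣ ≡ sum (λ v → k * ⟦ v ∈? p ⟧)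
*∣∣≡sum k p = trans (cong (k *_) (∣∣≡sum p)) (*-distribˡ-sum k (λ v → ⟦ v ∈? p ⟧))

module _ {n : ℕ} {P : Fin n → Set} (P? : ∀ v → Dec (P v)) where

  abstract
    comprehension : Subset n
    comprehension = tabulate (does ∘ P?)

    ∈-comprehension⁺ : ∀ {v} → P v → v ∈ comprehension
    ∈-comprehension⁺ {v} p = lookup⇒[]= v _ (trans (lookup∘tabulate _ v) (dec-true (P? v) p))

    ∈-comprehension⁻ : ∀ {v} → v ∈ comprehension → P v
    ∈-comprehension⁻ {v} v∈ with P? v in eq
    ... | yes p = p
    ... | no ¬p with trans (sym ([]=⇒lookup v∈)) (trans (lookup∘tabulate _ v) (cong does eq))
    ... | ()

∣p∪q∣≤∣p∣+∣q∣ : ∀ {n} (p q : Subset n) → ∣ p ∪ q ∣ ≤ ∣ p ∣ + ∣ q ∣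
∣p∪q∣≤∣p∣+∣q∣ [] [] = z≤n
∣p∪q∣≤∣p∣+∣q∣ (outside ∷ p) (outside ∷ q) = ∣p∪q∣≤∣p∣+∣q∣ p q
∣p∪q∣≤∣p∣+∣q∣ (outside ∷ p) (inside ∷ q) =
  ≤-trans (s≤s (∣p∪q∣≤∣p∣+∣q∣ p q)) (≤-reflexive (sym (+-suc ∣ p ∣ ∣ q ∣)))
∣p∪q∣≤∣p∣+∣q∣ (inside ∷ p) (outside ∷ q) = s≤s (∣p∪q∣≤∣p∣+∣q∣ p q)
∣p∪q∣≤∣p∣+∣q∣ (inside ∷ p) (inside ∷ q) =
  s≤s (≤-trans (∣p∪q∣≤∣p∣+∣q∣ p q) (+-monoʳ-≤ ∣ p ∣ (n≤1+n _)))

∣p∣+∣q∣≤∣p∪q∣ : ∀ {n} (p q : Subset n) → (∀ {v} → v ∈ p → v ∉ q) → ∣ p ∣ + ∣ q ∣ ≤ ∣ p ∪ q ∣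
∣p∣+∣q∣≤∣p∪q∣ p q disjoint = begin
  ∣ p ∣ + ∣ q ∣                                          ≡⟨ cong₂ _+_ (∣∣≡sum p) (∣∣≡sum q) ⟩
  sum (λ v → ⟦ v ∈? p ⟧) + sum (λ v → ⟦ v ∈? q ⟧)        ≡⟨ ∑-distrib-+ (λ v → ⟦ v ∈? p ⟧) (λ v → ⟦ v ∈? q ⟧) ⟨
  sum (λ v → ⟦ v ∈? p ⟧ + ⟦ v ∈? q ⟧)                    ≤⟨ sum-mono pointwise ⟩
  sum (λ v → ⟦ v ∈? p ∪ q ⟧)                             ≡⟨ ∣∣≡sum (p ∪ q) ⟨
  ∣ p ∪ q ∣                                              ∎
  where
  open ≤-Reasoning
  pointwise : ∀ v → ⟦ v ∈? p ⟧ + ⟦ v ∈? q ⟧ ≤ ⟦ v ∈? p ∪ q ⟧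
  pointwise v with v ∈? p | v ∈? q
  ... | yes v∈p | yes v∈q = contradiction v∈q (disjoint v∈p)
  ... | yes v∈p | no _ = ≤-reflexive (sym (⟦⟧-yes (v ∈? p ∪ q) (x∈p∪q⁺ (inj₁ v∈p))))
  ... | no _ | yes v∈q = ≤-reflexive (sym (⟦⟧-yes (v ∈? p ∪ q) (x∈p∪q⁺ (inj₂ v∈q))))
  ... | no _ | no _ = z≤n

insert< : ∀ {n} {p : Subset n} {x} → x ∉ p → ∣ p ∣ < ∣ p ∪ ⁅ x ⁆ ∣
insert< {p = p} {x} x∉p =
  p⊂q⇒∣p∣<∣q∣ (p⊆p∪q ⁅ x ⁆ , x , x∈p∪q⁺ (inj₂ (x∈⁅x⁆ x)) , x∉p)

∣insert∣≤ : ∀ {n} (p : Subset n) x → ∣ p ∪ ⁅ x ⁆ ∣ ≤ suc ∣ p ∣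
∣insert∣≤ p x = ≤-trans (∣p∪q∣≤∣p∣+∣q∣ p ⁅ x ⁆)
  (≤-reflexive (trans (cong (∣ p ∣ +_) (∣⁅x⁆∣≡1 x)) (+-comm ∣ p ∣ 1)))

∈-insert⁻ : ∀ {n} (p : Subset n) {x v} → v ∈ p ∪ ⁅ x ⁆ → v ∈ p ⊎ v ≡ x
∈-insert⁻ p {x} v∈ with x∈p∪q⁻ p ⁅ x ⁆ v∈
... | inj₁ v∈p = inj₁ v∈p
... | inj₂ v∈x = inj₂ (x∈⁅y⁆⇒x≡y x v∈x)

cover≤ : ∀ {n} (xs : List (Fin n)) {p q : Subset n} →
  (∀ {v} → v ∈ p → v ∈ q ⊎ v ∈ₗ xs) → ∣ p ∣ ≤ length xs + ∣ q ∣
cover≤ [] covered = p⊆q⇒∣p∣≤∣q∣ λ v∈p → [ (λ v∈q → v∈q) , (λ ()) ]′ (covered v∈p)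
cover≤ (x ∷ xs) {p} {q} covered = begin
  ∣ p ∣                          ≤⟨ cover≤ xs covered′ ⟩
  length xs + ∣ q ∪ ⁅ x ⁆ ∣      ≤⟨ +-monoʳ-≤ (length xs) (∣insert∣≤ q x) ⟩
  length xs + suc ∣ q ∣          ≡⟨ +-suc (length xs) ∣ q ∣ ⟩
  suc (length xs) + ∣ q ∣        ∎
  where
  open ≤-Reasoning
  covered′ : ∀ {v} → v ∈ p → v ∈ q ∪ ⁅ x ⁆ ⊎ v ∈ₗ xs
  covered′ v∈p with covered v∈p
  ... | inj₁ v∈q = inj₁ (x∈p∪q⁺ (inj₁ v∈q))
  ... | inj₂ (here refl) = inj₁ (x∈p∪q⁺ (inj₂ (x∈⁅x⁆ x)))
  ... | inj₂ (there v∈xs) = inj₂ v∈xs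

module _ {n : ℕ} (W : Subset n) (xs : List (Fin n)) where

  private
    kept? : ∀ v → Dec (v ∈ W × ¬ v ∈ₗ xs)
    kept? v = (v ∈? W) ×-dec ¬? (mem? _≟ᶠ_ v xs)

  without : Subset n
  without = comprehension kept?

  ∈-without⁻ : ∀ {v} → v ∈ without → v ∈ W × ¬ v ∈ₗ xs
  ∈-without⁻ = ∈-comprehension⁻ kept?

  ∈-without⁺ : ∀ {v} → v ∈ W → ¬ v ∈ₗ xs → v ∈ without
  ∈-without⁺ v∈W v∉xs = ∈-comprehension⁺ kept? (v∈W , v∉xs)

  ∣∣≤without : ∣ W ∣ ≤ length xs + ∣ without ∣
  ∣∣≤without = cover≤ xs λ {v} → split v
    where
    split : ∀ v → v ∈ W → v ∈ without ⊎ v ∈ₗ xs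
    split v v∈W with mem? _≟ᶠ_ v xs
    ... | yes v∈xs = inj₂ v∈xs
    ... | no v∉xs = inj₁ (∈-without⁺ v∈W v∉xs)

  without< : ∀ {x} → x ∈ W → x ∈ₗ xs → ∣ without ∣ < ∣ W ∣
  without< {x} x∈W x∈xs = p⊂q⇒∣p∣<∣q∣
    (proj₁ ∘ ∈-without⁻ , x , x∈W , λ x∈ → proj₂ (∈-without⁻ x∈) x∈xs)

-- Maximum independent sets

max-subset : ∀ {n} {P : Subset n → Set} → (∀ p → Dec (P p)) → P ⊥ →
  ∃ λ p → P p × (∀ q → P q → ∣ q ∣ ≤ ∣ p ∣)
max-subset {n} {P} P? P⊥ = search n ⊥ P⊥ 
  (≤-reflexive (trans (sym (+-identityʳ n)) (cong (n +_) (sym (∣⊥∣≡0 n)))))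
  where
  -- `k` bounds the room `n - ∣ p ∣` above `p`. Every strictly larger set uses up a unit of it, and
  -- with no room left `p` is maximum.
  search : ∀ k p → P p → n ≤ k + ∣ p ∣ → ∃ λ p → P p × (∀ q → P q → ∣ q ∣ ≤ ∣ p ∣)
  search zero p Pp n≤ = p , Pp , λ q _ → ≤-trans (∣p∣≤n q) n≤
  search (suc k) p Pp n≤ with anySubset? (λ q → P? q ×-dec (∣ p ∣ <? ∣ q ∣))
  ... | yes (q , Pq , p<q) = search k q Pq
    (≤-trans n≤ (≤-trans (≤-reflexive (sym (+-suc k ∣ p ∣))) (+-monoʳ-≤ k p<q)))
  ... | no ¬larger = p , Pp , λ q Pq → ≮⇒≥ λ p<q → ¬larger (q , Pq , p<q)

record SimpleGraph (n : ℕ) : Set₁ where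
  field
    E : Fin n → Fin n → Set
    E? : ∀ u v → Dec (E u v)
    E-sym : ∀ {u v} → E u v → E v u
    E-irr : ∀ {v} → ¬ E v v

  Independent : Subset n → Set
  Independent I = ∀ u v → u ∈ I → v ∈ I → ¬ E u v

  IndependentIn : Subset n → Subset n → Set
  IndependentIn W I = I ⊆ W × Independent I

  independentIn? : ∀ W I → Dec (IndependentIn W I)
  independentIn? W I = (I ⊆? W) ×-dec
    all? (λ u → all? (λ v → (u ∈? I) →-dec ((v ∈? I) →-dec ¬? (E? u v))))

  abstract
    max-independent : ∀ W → ∃ λ I → IndependentIn W I × (∀ J → IndependentIn W J → ∣ J ∣ ≤ ∣ I ∣)
    max-independent W = max-subset (independentIn? W)
      (⊆-min W , λ u v u∈⊥ → ⊥-elim (∉⊥ u∈⊥))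

  insert-independent : ∀ {I x} → Independent I → (∀ {v} → v ∈ I → ¬ E x v) → Independent (I ∪ ⁅ x ⁆)
  insert-independent {I} indep free u v u∈ v∈ Euv with ∈-insert⁻ I u∈ | ∈-insert⁻ I v∈
  ... | inj₁ u∈I | inj₁ v∈I = indep u v u∈I v∈I Euv
  ... | inj₁ u∈I | inj₂ refl = free u∈I (E-sym Euv)
  ... | inj₂ refl | inj₁ v∈I = free v∈I Euv
  ... | inj₂ refl | inj₂ refl = E-irr Euv

  insert-independentIn : ∀ {W I x} → IndependentIn W I → x ∈ W →
    (∀ {v} → v ∈ I → ¬ E x v) → IndependentIn W (I ∪ ⁅ x ⁆)
  insert-independentIn {I = I} (I⊆W , indep) x∈W free =
    (λ v∈ → [ I⊆W , (λ { refl → x∈W }) ]′ (∈-insert⁻ I v∈)) , insert-independent indep free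

  max-independent-blocks : ∀ {W I} → IndependentIn W I → (∀ J → IndependentIn W J → ∣ J ∣ ≤ ∣ I ∣) →
    ∀ {v} → v ∈ W → v ∉ I → ∃ λ u → u ∈ I × E v u
  max-independent-blocks {W} {I} indepIn maximum {v} v∈W v∉I
    with any? (λ u → (u ∈? I) ×-dec E? v u)
  ... | yes found = found
  ... | no none = contradiction
    (maximum _ (insert-independentIn indepIn v∈W λ {u} u∈I Evu → none (u , u∈I , Evu)))
    (<⇒≱ (insert< v∉I))

  abstract
    maximal-independent : ∀ W → ∃ λ I → IndependentIn W I ×
      (∀ {v} → v ∈ W → v ∉ I → ∃ λ u → u ∈ I × E v u)
    maximal-independent W =
      proj₁ (max-independent W) , proj₁ (proj₂ (max-independent W)) ,
      max-independent-blocks (proj₁ (proj₂ (max-independent W))) (proj₂ (proj₂ (max-independent W)))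

-- Subcubic graphs

-- Four elements occupy three slots, so two of them share one; as `a`, `b`, `c` are distinct, `d`
-- belongs to the colliding pair. This recognises a full neighbourhood.
fourth-in-three-slots : {A : Set} {f : Fin 3 → A} {a b c d : A} →
  (∃ λ i → f i ≡ a) → (∃ λ i → f i ≡ b) → (∃ λ i → f i ≡ c) → (∃ λ i → f i ≡ d) →
  a ≢ b → a ≢ c → b ≢ c → d ∈ₗ a ∷ b ∷ c ∷ []
fourth-in-three-slots {f = f} (i , refl) (j , refl) (k , refl) (l , refl) a≢b a≢c b≢c
  with pigeonhole ≤-refl (Vec.lookup (i ∷ j ∷ k ∷ l ∷ []))
... | zero , suc zero , _ , eq = contradiction (cong f eq) a≢b
... | zero , suc (suc zero) , _ , eq = contradiction (cong f eq) a≢c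
... | zero , suc (suc (suc zero)) , _ , eq = here (cong f (sym eq))
... | suc zero , suc (suc zero) , _ , eq = contradiction (cong f eq) b≢c
... | suc zero , suc (suc (suc zero)) , _ , eq = there (here (cong f (sym eq)))
... | suc (suc zero) , suc (suc (suc zero)) , _ , eq = there (there (here (cong f (sym eq))))
... | suc zero , suc zero , s≤s () , _
... | suc (suc zero) , suc zero , s≤s () , _
... | suc (suc zero) , suc (suc zero) , s≤s (s≤s ()) , _
... | suc (suc (suc zero)) , suc zero , s≤s () , _
... | suc (suc (suc zero)) , suc (suc zero) , s≤s (s≤s ()) , _
... | suc (suc (suc zero)) , suc (suc (suc zero)) , s≤s (s≤s (s≤s ())) , _

module _ {n : ℕ} (C : SimpleGraph n) where
  open SimpleGraph C

  -- Maximum degree at most three inside W; unused slots hold arbitrary vertices.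
  record Subcubic (W : Subset n) : Set where
    field
      slot : Fin n → Fin 3 → Fin n
      covers : ∀ {u v} → u ∈ W → v ∈ W → E u v → ∃ λ i → slot u i ≡ v

  TriangleFree : Subset n → Set
  TriangleFree W = ∀ {a b c} → a ∈ W → b ∈ W → c ∈ W → E a b → E a c → ¬ E b c

  K₄Free : Subset n → Set
  K₄Free W = ∀ {a b c d} → a ∈ W → b ∈ W → c ∈ W → d ∈ W →
    E a b → E a c → E a d → E b c → E b d → ¬ E c d

  LargeIndependent : Subset n → Set
  LargeIndependent W = ∃ λ I → IndependentIn W I × ∣ W ∣ ≤ 3 * ∣ I ∣

  adjacent⇒≢ : ∀ {u v} → E u v → u ≢ v
  adjacent⇒≢ Euv refl = E-irr Euv

  Subcubic-⊆ : ∀ {W W′} → W′ ⊆ W → Subcubic W → Subcubic W′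
  Subcubic-⊆ W′⊆W sub = record
    { slot = slot ; covers = λ u∈ v∈ → covers (W′⊆W u∈) (W′⊆W v∈) }
    where open Subcubic sub

  module _ {W : Subset n} (subcubic : Subcubic W) where
    open Subcubic subcubic

    neighbours-of : ∀ {x a b c v} → x ∈ W → a ∈ W → b ∈ W → c ∈ W → E x a → E x b → E x c →
      a ≢ b → a ≢ c → b ≢ c → v ∈ W → E x v → v ∈ₗ a ∷ b ∷ c ∷ []
    neighbours-of x∈ a∈ b∈ c∈ xa xb xc a≢b a≢c b≢c v∈ xv = fourth-in-three-slots
      (covers x∈ a∈ xa) (covers x∈ b∈ xb) (covers x∈ c∈ xc) (covers x∈ v∈ xv) a≢b a≢c b≢c

    third-neighbour : ∀ {x a b} → x ∈ W → a ∈ W → b ∈ W → E x a → E x b → a ≢ b →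
      (∃ λ c → c ∈ W × E x c × c ≢ a × c ≢ b) ⊎ (∀ {v} → v ∈ W → E x v → v ∈ₗ a ∷ b ∷ [])
    third-neighbour {x} {a} {b} x∈ a∈ b∈ xa xb a≢b
      with any? (λ c → (c ∈? W) ×-dec E? x c ×-dec ¬? (c ≟ᶠ a) ×-dec ¬? (c ≟ᶠ b))
    ... | yes found = inj₁ found
    ... | no none = inj₂ λ {v} → only v
      where
      only : ∀ v → v ∈ W → E x v → v ∈ₗ a ∷ b ∷ []
      only v v∈ xv with v ≟ᶠ a | v ≟ᶠ b
      ... | yes refl | _ = here refl
      ... | no _ | yes refl = there (here refl)
      ... | no v≢a | no v≢b = contradiction (v , v∈ , xv , v≢a , v≢b) none

    remaining-neighbour : ∀ {x a b} → x ∈ W → a ∈ W → b ∈ W → E x a → E x b → a ≢ b →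
      ∃ λ c → ∀ {v} → v ∈ W → E x v → v ∈ₗ a ∷ b ∷ c ∷ []
    remaining-neighbour {x} x∈ a∈ b∈ xa xb a≢b with third-neighbour x∈ a∈ b∈ xa xb a≢b
    ... | inj₁ (c , c∈ , xc , c≢a , c≢b) =
      c , neighbours-of x∈ a∈ b∈ c∈ xa xb xc a≢b (c≢a ∘ sym) (c≢b ∘ sym)
    -- `x` is a placeholder: with only two neighbours the third position may hold any vertex.
    ... | inj₂ only = x , λ v∈ xv → pad (only v∈ xv)
      where
      pad : ∀ {a b c v} → v ∈ₗ a ∷ b ∷ [] → v ∈ₗ a ∷ b ∷ c ∷ []
      pad (here e) = here e
      pad (there (here e)) = there (here e)

    -- In a maximum independent set I, a vertex outside I has two neighbours in I or is the private
    -- neighbour of one; without triangles, exchanging makes the private neighbour unique. So each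
    -- vertex of I serves at most 3 + 1 of the 2 |W ∖ I| requests.
    triangle-free-independent : TriangleFree W → LargeIndependent W
    triangle-free-independent no-triangle = I , indepIn , W≤3I
      where
      I : Subset n
      I = proj₁ (max-independent W)
      indepIn : IndependentIn W I
      indepIn = proj₁ (proj₂ (max-independent W))
      maximum : ∀ J → IndependentIn W J → ∣ J ∣ ≤ ∣ I ∣
      maximum = proj₂ (proj₂ (max-independent W))
      O : Subset n
      O = comprehension (λ v → (v ∈? W) ×-dec ¬? (v ∈? I))
      ∈O⁻ : ∀ {v} → v ∈ O → v ∈ W × v ∉ I
      ∈O⁻ = ∈-comprehension⁻ (λ v → (v ∈? W) ×-dec ¬? (v ∈? I))

      Private : Fin n → Fin n → Set
      Private v t = t ∈ I × v ∈ W × v ∉ I × E v t × (∀ u → u ∈ I → E v u → u ≡ t)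
      private? : ∀ v t → Dec (Private v t)
      private? v t = (t ∈? I) ×-dec (v ∈? W) ×-dec ¬? (v ∈? I) ×-dec E? v t ×-dec
        all? (λ u → (u ∈? I) →-dec (E? v u →-dec (u ≟ᶠ t)))

      private-unique : ∀ {t v w} → Private v t → Private w t → v ≡ w
      private-unique {t} {v} {w} (t∈I , v∈W , v∉I , vt , v-only) (_ , w∈W , w∉I , wt , w-only)
        with v ≟ᶠ w
      ... | yes v≡w = v≡w
      ... | no v≢w = contradiction (maximum J J-indep) (<⇒≱ larger)
        where
        -- The exchange gives up `t` for both `v` and `w`. Neither has another neighbour in `I`, and
        -- an edge between them would close a triangle with `t`.
        I₀ = without I (t ∷ [])
        I₁ = I₀ ∪ ⁅ v ⁆
        J = I₁ ∪ ⁅ w ⁆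
        I₀⊆I : I₀ ⊆ I
        I₀⊆I = proj₁ ∘ ∈-without⁻ I (t ∷ [])
        free : ∀ {x u} → (∀ u → u ∈ I → E x u → u ≡ t) → u ∈ I₀ → ¬ E x u
        free x-only u∈ xu =
          proj₂ (∈-without⁻ I (t ∷ []) u∈) (here (x-only _ (I₀⊆I u∈) xu))
        I₀-indep : IndependentIn W I₀
        I₀-indep = proj₁ indepIn ∘ I₀⊆I ,
          λ a b a∈ b∈ → proj₂ indepIn a b (I₀⊆I a∈) (I₀⊆I b∈)
        vw : ¬ E w v
        vw wv = no-triangle w∈W v∈W (proj₁ indepIn t∈I) wv wt vt
        J-indep : IndependentIn W J
        J-indep = insert-independentIn (insert-independentIn I₀-indep v∈W (free v-only)) w∈W
          λ u∈ wu → [ (λ u∈I₀ → free w-only u∈I₀ wu) , (λ { refl → vw wu }) ]′ (∈-insert⁻ I₀ u∈)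
        w∉I₁ : w ∉ I₁
        w∉I₁ w∈ = [ w∉I ∘ I₀⊆I , v≢w ∘ sym ]′ (∈-insert⁻ I₀ w∈)
        larger : ∣ I ∣ < ∣ J ∣
        larger = ≤-<-trans (∣∣≤without I (t ∷ []))
          (≤-<-trans (insert< (v∉I ∘ I₀⊆I)) (insert< w∉I₁))

      slots : Fin n → Fin n → ℕ
      slots v t = sum (λ i → ⟦ slot t i ≟ᶠ v ⟧)
      -- The charge from `v` to `t ∈ I`: one for each slot of `t` holding `v`, and one more if `v`
      -- is a private neighbour of `t`.
      h : Fin n → Fin n → ℕ
      h v t = ⟦ t ∈? I ⟧ * (slots v t + ⟦ private? v t ⟧)

      1≤slots : ∀ {v t} → v ∈ W → t ∈ I → E v t → 1 ≤ slots v t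
      1≤slots {v} {t} v∈ t∈ vt with covers (proj₁ indepIn t∈) v∈ (E-sym vt)
      ... | i , eq = ≤-trans (≤-reflexive (sym (⟦⟧-yes (slot t i ≟ᶠ v) eq)))
        (term≤sum (λ i → ⟦ slot t i ≟ᶠ v ⟧) i)

      h-at : ∀ {v t} → t ∈ I → h v t ≡ slots v t + ⟦ private? v t ⟧
      h-at {v} {t} t∈ rewrite ⟦⟧-yes (t ∈? I) t∈ = *-identityˡ _

      request : ∀ v → 2 * ⟦ v ∈? O ⟧ ≤ sum (h v)
      request v with v ∈? O
      ... | no _ = z≤n
      ... | yes v∈O with ∈O⁻ v∈O
      ... | v∈W , v∉I with max-independent-blocks indepIn maximum v∈W v∉I
      ... | t , t∈I , vt with any? (λ u → (u ∈? I) ×-dec E? v u ×-dec ¬? (u ≟ᶠ t))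
      ... | yes (u , u∈I , vu , u≢t) = ≤-trans
        (+-mono-≤ (≤-trans (≤-trans (1≤slots v∈W u∈I vu) (m≤m+n _ _)) (≤-reflexive (sym (h-at u∈I))))
                  (≤-trans (≤-trans (1≤slots v∈W t∈I vt) (m≤m+n _ _)) (≤-reflexive (sym (h-at t∈I)))))
        (two-terms≤sum (h v) u≢t)
      -- Here `t` is the only neighbour in `I`, so its slot and its private bonus together supply
      -- the two units.
      ... | no none = ≤-trans
        (≤-trans
          (+-mono-≤ (1≤slots v∈W t∈I vt) (≤-reflexive (sym (⟦⟧-yes (private? v t) v-private))))
          (≤-reflexive (sym (h-at t∈I))))
        (term≤sum (h v) t)
        where
        only : ∀ u → u ∈ I → E v u → u ≡ t
        only u u∈I vu with u ≟ᶠ t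
        ... | yes u≡t = u≡t
        ... | no u≢t = contradiction (u , u∈I , vu , u≢t) none
        v-private : Private v t
        v-private = t∈I , v∈W , v∉I , vt , only

      serve : ∀ t → sum (λ v → h v t) ≤ 4 * ⟦ t ∈? I ⟧
      serve t = begin
        sum (λ v → h v t)
          ≡⟨ *-distribˡ-sum ⟦ t ∈? I ⟧ (λ v → slots v t + ⟦ private? v t ⟧) ⟨
        ⟦ t ∈? I ⟧ * sum (λ v → slots v t + ⟦ private? v t ⟧)
          ≡⟨ cong (⟦ t ∈? I ⟧ *_) (∑-distrib-+ (λ v → slots v t) (λ v → ⟦ private? v t ⟧)) ⟩
        ⟦ t ∈? I ⟧ * (sum (λ v → slots v t) + sum (λ v → ⟦ private? v t ⟧))
          ≤⟨ *-monoʳ-≤ ⟦ t ∈? I ⟧ (+-mono-≤ slots≤3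
               (sum-unique≤1 (λ v → private? v t) private-unique)) ⟩
        ⟦ t ∈? I ⟧ * 4
          ≡⟨ *-comm ⟦ t ∈? I ⟧ 4 ⟩
        4 * ⟦ t ∈? I ⟧ ∎
        where
        open ≤-Reasoning
        slots≤3 : sum (λ v → slots v t) ≤ 3
        slots≤3 = ≤-trans (≤-reflexive (∑-comm (λ v i → ⟦ slot t i ≟ᶠ v ⟧)))
          (sum-mono {f = λ i → sum (λ v → ⟦ slot t i ≟ᶠ v ⟧)} {g = λ (_ : Fin 3) → 1} λ i →
            sum-unique≤1 (λ v → slot t i ≟ᶠ v) λ p q → trans (sym p) q)

      2O≤4I : 2 * ∣ O ∣ ≤ 4 * ∣ I ∣
      2O≤4I = ≤-trans (≤-reflexive (*∣∣≡sum 2 O))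
        (≤-trans (double-count h request serve) (≤-reflexive (sym (*∣∣≡sum 4 I))))

      W≤3I : ∣ W ∣ ≤ 3 * ∣ I ∣
      W≤3I = begin
        ∣ W ∣             ≤⟨ p⊆q⇒∣p∣≤∣q∣ {p = W} {q = I ∪ O} (λ {v} → W⊆ v) ⟩
        ∣ I ∪ O ∣         ≤⟨ ∣p∪q∣≤∣p∣+∣q∣ I O ⟩
        ∣ I ∣ + ∣ O ∣     ≤⟨ +-monoʳ-≤ ∣ I ∣ (*-cancelˡ-≤ 2 (≤-trans 2O≤4I (≤-reflexive (*-assoc 2 2 ∣ I ∣)))) ⟩
        3 * ∣ I ∣         ∎
        where
        open ≤-Reasoning
        W⊆ : ∀ v → v ∈ W → v ∈ I ∪ O
        W⊆ v v∈W with v ∈? I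
        ... | yes v∈I = x∈p∪q⁺ (inj₁ v∈I)
        ... | no v∉I = x∈p∪q⁺ (inj₂ (∈-comprehension⁺ (λ v → (v ∈? W) ×-dec ¬? (v ∈? I)) (v∈W , v∉I)))

-- Reductions that delete at most three vertices per vertex gained

*-three-suc : ∀ {w m i j} → w ≤ 3 + m → m ≤ 3 * i → i < j → w ≤ 3 * j
*-three-suc {w} {m} {i} {j} w≤ m≤ i<j = begin
  w            ≤⟨ w≤ ⟩
  3 + m        ≤⟨ +-monoʳ-≤ 3 m≤ ⟩
  3 + 3 * i    ≡⟨ *-suc 3 i ⟨
  3 * suc i    ≤⟨ *-monoʳ-≤ 3 i<j ⟩
  3 * j        ∎
  where open ≤-Reasoning

module _ {n : ℕ} (C : SimpleGraph n) where
  open SimpleGraph C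

  -- All neighbours of `x` in `W` are deleted, so `x` can join any independent set of the rest. `xs`
  -- may contain repetitions or vertices outside `W`: its length only bounds the number of deleted
  -- vertices from above.
  extend-by-one : ∀ {W x} xs → x ∈ W → x ∈ₗ xs → (∀ {v} → v ∈ W → E x v → v ∈ₗ xs) →
    length xs ≤ 3 → LargeIndependent C (without W xs) → LargeIndependent C W
  extend-by-one {W} {x} xs x∈W x∈xs closed short (I , (I⊆ , indep) , bound) =
    I ∪ ⁅ x ⁆ ,
    insert-independentIn (proj₁ ∘ ∈I⁻ , indep) x∈W
      (λ v∈I xv → proj₂ (∈I⁻ v∈I) (closed (proj₁ (∈I⁻ v∈I)) xv)) ,
    *-three-suc (≤-trans (∣∣≤without W xs) (+-monoˡ-≤ _ short)) bound
      (insert< λ x∈I → proj₂ (∈I⁻ x∈I) x∈xs)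
    where
    ∈I⁻ : ∀ {v} → v ∈ I → v ∈ W × ¬ v ∈ₗ xs
    ∈I⁻ = ∈-without⁻ W xs ∘ I⊆

  -- Two nonadjacent vertices are gained for six deleted ones. Treating them jointly matters when
  -- their neighbourhoods overlap: each closed neighbourhood alone may have four vertices.
  extend-by-two : ∀ {W x y} xs → x ∈ W → y ∈ W → x ≢ y → ¬ E x y → x ∈ₗ xs → y ∈ₗ xs →
    (∀ {v} → v ∈ W → E x v → v ∈ₗ xs) → (∀ {v} → v ∈ W → E y v → v ∈ₗ xs) →
    length xs ≤ 6 → LargeIndependent C (without W xs) → LargeIndependent C W
  extend-by-two {W} {x} {y} xs x∈W y∈W x≢y ¬xy x∈xs y∈xs x-closed y-closed short
    (I , (I⊆ , indep) , bound) =
    I ∪ ⁅ x ⁆ ∪ ⁅ y ⁆ ,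
    subst (IndependentIn W) (∪-assoc I ⁅ x ⁆ ⁅ y ⁆)
      (insert-independentIn
        (insert-independentIn (proj₁ ∘ ∈I⁻ , indep) x∈W
          (λ v∈I xv → proj₂ (∈I⁻ v∈I) (x-closed (proj₁ (∈I⁻ v∈I)) xv)))
        y∈W
        (λ v∈ yv → [ (λ v∈I → proj₂ (∈I⁻ v∈I) (y-closed (proj₁ (∈I⁻ v∈I)) yv))
                   , (λ { refl → ¬xy (E-sym yv) }) ]′ (∈-insert⁻ I v∈))) ,
    *-three-suc {m = 3 + ∣ without W xs ∣}
      (≤-trans (∣∣≤without W xs) (+-monoˡ-≤ _ short))
      (*-three-suc ≤-refl bound (insert< λ x∈I → proj₂ (∈I⁻ x∈I) x∈xs))
      (subst (λ J → ∣ I ∪ ⁅ x ⁆ ∣ < ∣ J ∣) (∪-assoc I ⁅ x ⁆ ⁅ y ⁆) (insert< y∉))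
    where
    ∈I⁻ : ∀ {v} → v ∈ I → v ∈ W × ¬ v ∈ₗ xs
    ∈I⁻ = ∈-without⁻ W xs ∘ I⊆
    y∉ : y ∉ I ∪ ⁅ x ⁆
    y∉ y∈ = [ (λ y∈I → proj₂ (∈I⁻ y∈I) y∈xs) , x≢y ∘ sym ]′ (∈-insert⁻ I y∈)

  module AddEdge {a b : Fin n} (a≢b : a ≢ b) where

    New : Fin n → Fin n → Set
    New u v = (u ≡ a × v ≡ b) ⊎ (u ≡ b × v ≡ a)

    graph : SimpleGraph n
    graph = record
      { E = λ u v → E u v ⊎ New u v
      ; E? = λ u v → E? u v ⊎-dec (((u ≟ᶠ a) ×-dec (v ≟ᶠ b)) ⊎-dec ((u ≟ᶠ b) ×-dec (v ≟ᶠ a)))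
      ; E-sym = λ { (inj₁ uv) → inj₁ (E-sym uv)
                  ; (inj₂ (inj₁ (p , q))) → inj₂ (inj₂ (q , p))
                  ; (inj₂ (inj₂ (p , q))) → inj₂ (inj₁ (q , p)) }
      ; E-irr = λ { (inj₁ vv) → E-irr vv
                  ; (inj₂ (inj₁ (p , q))) → a≢b (trans (sym p) q)
                  ; (inj₂ (inj₂ (p , q))) → a≢b (trans (sym q) p) } }

    open SimpleGraph graph using () renaming (E to E′; E-sym to E′-sym)

    old : ∀ {u v} → E′ u v → v ≢ a → v ≢ b → E u v
    old (inj₁ uv) _ _ = uv
    old (inj₂ (inj₁ (_ , v≡b))) _ v≢b = contradiction v≡b v≢b
    old (inj₂ (inj₂ (_ , v≡a))) v≢a _ = contradiction v≡a v≢a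

    -- The new edge reuses the slots that the deleted vertices x and y occupied at a and b.
    subcubic : ∀ {W W′ x y} → W′ ⊆ W → Subcubic C W → a ∈ W → b ∈ W → x ∈ W → y ∈ W →
      x ∉ W′ → y ∉ W′ → E a x → E b y → Subcubic graph W′
    subcubic {W} {W′} {x} {y} W′⊆W sub a∈ b∈ x∈ y∈ x∉ y∉ ax by =
      record { slot = slot′ ; covers = covers′ }
      where
      open Subcubic sub
      first? : ∀ u i → Dec (u ≡ a × slot u i ≡ x)
      first? u i = (u ≟ᶠ a) ×-dec (slot u i ≟ᶠ x)
      second? : ∀ u i → Dec (u ≡ b × slot u i ≡ y)
      second? u i = (u ≟ᶠ b) ×-dec (slot u i ≟ᶠ y)
      slot′ : Fin n → Fin 3 → Fin n
      slot′ u i = if does (first? u i) then b else if does (second? u i) then a else slot u i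
      covers′ : ∀ {u v} → u ∈ W′ → v ∈ W′ → E′ u v → ∃ λ i → slot′ u i ≡ v
      covers′ {u} u∈ v∈ (inj₁ uv) with covers (W′⊆W u∈) (W′⊆W v∈) uv
      ... | i , refl = i , covered
        where
        covered : slot′ u i ≡ slot u i
        covered
          rewrite dec-false (first? u i) (λ (_ , eq) → x∉ (subst (_∈ W′) eq v∈))
                | dec-false (second? u i) (λ (_ , eq) → y∉ (subst (_∈ W′) eq v∈)) = refl
      covers′ u∈ v∈ (inj₂ (inj₁ (refl , refl))) with covers a∈ x∈ ax
      ... | i , eq = i , covered
        where
        covered : slot′ a i ≡ b
        covered rewrite dec-true (first? a i) (refl , eq) = refl
      covers′ u∈ v∈ (inj₂ (inj₂ (refl , refl))) with covers b∈ y∈ by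
      ... | i , eq = i , covered
        where
        covered : slot′ b i ≡ a
        covered
          rewrite dec-false (first? b i) (λ (b≡a , _) → a≢b (sym b≡a))
                | dec-true (second? b i) (refl , eq) = refl

    -- In a K₄ through the new edge, the other two vertices `p`, `q` differ from `a` and `b`, so its
    -- remaining five edges are old. They form a K₄ minus the edge `a b`, which the second
    -- hypothesis excludes.
    K₄-free : ∀ {W} → K₄Free C W →
      (∀ {p q} → p ∈ W → q ∈ W → E a p → E a q → E b p → E b q → ¬ E p q) → K₄Free graph W
    K₄-free {W} free no-diamond {p₁} {p₂} {p₃} {p₄} p₁∈ p₂∈ p₃∈ p₄∈ = check
      where
      E′⇒≢ : ∀ {u v} → E′ u v → v ≢ u
      E′⇒≢ uv refl = SimpleGraph.E-irr graph uv
      uses-new : ∀ {u v p q} → New u v → p ∈ W → q ∈ W →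
        E′ u p → E′ u q → E′ v p → E′ v q → ¬ E′ p q
      uses-new (inj₁ (refl , refl)) p∈ q∈ ap aq bp bq pq = no-diamond p∈ q∈
        (old ap (E′⇒≢ ap) (E′⇒≢ bp)) (old aq (E′⇒≢ aq) (E′⇒≢ bq))
        (old bp (E′⇒≢ ap) (E′⇒≢ bp)) (old bq (E′⇒≢ aq) (E′⇒≢ bq)) (old pq (E′⇒≢ aq) (E′⇒≢ bq))
      uses-new (inj₂ (refl , refl)) p∈ q∈ bp bq ap aq pq = no-diamond p∈ q∈
        (old ap (E′⇒≢ ap) (E′⇒≢ bp)) (old aq (E′⇒≢ aq) (E′⇒≢ bq))
        (old bp (E′⇒≢ ap) (E′⇒≢ bp)) (old bq (E′⇒≢ aq) (E′⇒≢ bq)) (old pq (E′⇒≢ aq) (E′⇒≢ bq))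
      s : ∀ {u v} → E′ u v → E′ v u
      s = E′-sym
      check : E′ p₁ p₂ → E′ p₁ p₃ → E′ p₁ p₄ → E′ p₂ p₃ → E′ p₂ p₄ → ¬ E′ p₃ p₄
      check (inj₂ new) e₁₃ e₁₄ e₂₃ e₂₄ e₃₄ = uses-new new p₃∈ p₄∈ e₁₃ e₁₄ e₂₃ e₂₄ e₃₄
      check e₁₂ (inj₂ new) e₁₄ e₂₃ e₂₄ e₃₄ = uses-new new p₂∈ p₄∈ e₁₂ e₁₄ (s e₂₃) e₃₄ e₂₄
      check e₁₂ e₁₃ (inj₂ new) e₂₃ e₂₄ e₃₄ = uses-new new p₂∈ p₃∈ e₁₂ e₁₃ (s e₂₄) (s e₃₄) e₂₃
      check e₁₂ e₁₃ e₁₄ (inj₂ new) e₂₄ e₃₄ = uses-new new p₁∈ p₄∈ (s e₁₂) e₂₄ (s e₁₃) e₃₄ e₁₄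
      check e₁₂ e₁₃ e₁₄ e₂₃ (inj₂ new) e₃₄ = uses-new new p₁∈ p₃∈ (s e₁₂) e₂₃ (s e₁₄) (s e₃₄) e₁₃
      check e₁₂ e₁₃ e₁₄ e₂₃ e₂₄ (inj₂ new) = uses-new new p₁∈ p₂∈ (s e₁₃) (s e₂₃) (s e₁₄) (s e₂₄) e₁₂
      check (inj₁ e₁₂) (inj₁ e₁₃) (inj₁ e₁₄) (inj₁ e₂₃) (inj₁ e₂₄) (inj₁ e₃₄) =
        free p₁∈ p₂∈ p₃∈ p₄∈ e₁₂ e₁₃ e₁₄ e₂₃ e₂₄ e₃₄

-- The independent-set form of Brooks' theorem for maximum degree three. A triangle whose vertices x, y
-- have distinct further neighbours a, b is deleted after joining a to b: then a and b are not both
-- chosen, so x or y can be added back.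
subcubic-independent : ∀ {n} k (C : SimpleGraph n) W → ∣ W ∣ ≤ k →
  Subcubic C W → K₄Free C W → LargeIndependent C W
subcubic-independent zero C W W≤ sub free =
  ⊥ , (⊆-min W , λ u v u∈⊥ → ⊥-elim (∉⊥ u∈⊥)) , ≤-trans W≤ z≤n
subcubic-independent {n} (suc k) C W W≤ sub free
  with any? (λ x → any? (λ y → any? (λ z → (x ∈? W) ×-dec (y ∈? W) ×-dec (z ∈? W) ×-dec
         SimpleGraph.E? C x y ×-dec SimpleGraph.E? C x z ×-dec SimpleGraph.E? C y z)))
... | no none = triangle-free-independent C sub
  λ {a} {b} {c} a∈ b∈ c∈ ab ac bc → none (a , b , c , a∈ , b∈ , c∈ , ab , ac , bc)
... | yes (x , y , z , x∈ , y∈ , z∈ , xy , xz , yz) = triangle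
    (third-neighbour C sub x∈ y∈ z∈ xy xz (adjacent⇒≢ C yz))
    (third-neighbour C sub y∈ x∈ z∈ (E-sym xy) yz (adjacent⇒≢ C xz))
  where
  open SimpleGraph C
  recurse : ∀ {v} xs → v ∈ W → v ∈ₗ xs → LargeIndependent C (without W xs)
  recurse xs v∈W v∈xs = subcubic-independent k C (without W xs)
    (≤-pred (≤-trans (without< W xs v∈W v∈xs) W≤))
    (Subcubic-⊆ C (proj₁ ∘ ∈-without⁻ W xs) sub)
    (λ a∈ b∈ c∈ d∈ → free (inside-W a∈) (inside-W b∈) (inside-W c∈) (inside-W d∈))
    where
    inside-W : ∀ {v} → v ∈ without W xs → v ∈ W
    inside-W = proj₁ ∘ ∈-without⁻ W xs
  xyz = x ∷ y ∷ z ∷ []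
  W′ = without W xyz
  W′⊆W : W′ ⊆ W
  W′⊆W = proj₁ ∘ ∈-without⁻ W xyz
  ∉xyz : ∀ {v} → v ∈ W′ → ¬ v ∈ₗ xyz
  ∉xyz = proj₂ ∘ ∈-without⁻ W xyz

  distinct : ∀ {a b} → a ∈ W → b ∈ W → E x a → E y b → a ≢ y → a ≢ z → b ≢ x → b ≢ z →
    a ≢ b → LargeIndependent C W
  distinct {a} {b} a∈ b∈ xa yb a≢y a≢z b≢x b≢z a≢b
    with any? (λ p → any? (λ q → (p ∈? W′) ×-dec (q ∈? W′) ×-dec
           E? a p ×-dec E? a q ×-dec E? b p ×-dec E? b q ×-dec E? p q))
  -- Joining `a` to `b` would create a K₄ here. But then the neighbours of `a` are `x`, `p`, `q` and
  -- those of `b` are `y`, `p`, `q`; as `a` and `b` are nonadjacent, both can be chosen at the price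
  -- of six vertices.
  ... | yes (p , q , p∈′ , q∈′ , ap , aq , bp , bq , pq) =
    extend-by-two C xs a∈ b∈ a≢b ¬ab 1st 2nd a-closed b-closed ≤-refl (recurse xs a∈ 1st)
    where
    xs = a ∷ b ∷ x ∷ y ∷ p ∷ q ∷ []
    p∈ = W′⊆W p∈′
    q∈ = W′⊆W q∈′
    ¬ab : ¬ E a b
    ¬ab ab = free a∈ b∈ p∈ q∈ ab ap aq bp bq pq
    a-closed : ∀ {v} → v ∈ W → E a v → v ∈ₗ xs
    a-closed v∈ av with neighbours-of C sub a∈ x∈ p∈ q∈ (E-sym xa) ap aq
      (λ { refl → ∉xyz p∈′ 1st }) (λ { refl → ∉xyz q∈′ 1st }) (adjacent⇒≢ C pq) v∈ av
    ... | 1st = 3rd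
    ... | 2nd = 5th
    ... | 3rd = 6th
    b-closed : ∀ {v} → v ∈ W → E b v → v ∈ₗ xs
    b-closed v∈ bv with neighbours-of C sub b∈ y∈ p∈ q∈ (E-sym yb) bp bq
      (λ { refl → ∉xyz p∈′ 2nd }) (λ { refl → ∉xyz q∈′ 2nd }) (adjacent⇒≢ C pq) v∈ bv
    ... | 1st = 4th
    ... | 2nd = 5th
    ... | 3rd = 6th
  ... | no none with subcubic-independent k (AddEdge.graph C a≢b) W′
          (≤-pred (≤-trans (without< W xyz x∈ 1st) W≤))
          (AddEdge.subcubic C a≢b W′⊆W sub a∈ b∈ x∈ y∈
            (λ x∈′ → ∉xyz x∈′ 1st) (λ y∈′ → ∉xyz y∈′ 2nd) (E-sym xa) (E-sym yb))
          (AddEdge.K₄-free C a≢b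
            (λ a∈ b∈ c∈ d∈ → free (W′⊆W a∈) (W′⊆W b∈) (W′⊆W c∈) (W′⊆W d∈))
            (λ {p} {q} p∈ q∈ ap aq bp bq pq → none (p , q , p∈ , q∈ , ap , aq , bp , bq , pq)))
  ... | I , (I⊆ , indep) , bound with a ∈? I
  ... | no a∉I = I ∪ ⁅ x ⁆ ,
    insert-independentIn (W′⊆W ∘ I⊆ , λ u v u∈ v∈ uv → indep u v u∈ v∈ (inj₁ uv)) x∈ not-x ,
    *-three-suc (∣∣≤without W xyz) bound (insert< λ x∈I → ∉xyz (I⊆ x∈I) 1st)
    where
    not-x : ∀ {v} → v ∈ I → ¬ E x v
    not-x v∈ xv with neighbours-of C sub x∈ y∈ z∈ a∈ xy xz xa (adjacent⇒≢ C yz)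
      (a≢y ∘ sym) (a≢z ∘ sym) (W′⊆W (I⊆ v∈)) xv
    ... | 1st = ∉xyz (I⊆ v∈) 2nd
    ... | 2nd = ∉xyz (I⊆ v∈) 3rd
    ... | 3rd = a∉I v∈
  ... | yes a∈I = I ∪ ⁅ y ⁆ ,
    insert-independentIn (W′⊆W ∘ I⊆ , λ u v u∈ v∈ uv → indep u v u∈ v∈ (inj₁ uv)) y∈ not-y ,
    *-three-suc (∣∣≤without W xyz) bound (insert< λ y∈I → ∉xyz (I⊆ y∈I) 2nd)
    where
    not-y : ∀ {v} → v ∈ I → ¬ E y v
    not-y v∈ yv with neighbours-of C sub y∈ x∈ z∈ b∈ (E-sym xy) yz yb (adjacent⇒≢ C xz)
      (b≢x ∘ sym) (b≢z ∘ sym) (W′⊆W (I⊆ v∈)) yv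
    ... | 1st = ∉xyz (I⊆ v∈) 1st
    ... | 2nd = ∉xyz (I⊆ v∈) 3rd
    ... | 3rd = indep a b a∈I v∈ (inj₂ (inj₁ (refl , refl)))

  triangle :
    ((∃ λ a → a ∈ W × E x a × a ≢ y × a ≢ z) ⊎ (∀ {v} → v ∈ W → E x v → v ∈ₗ y ∷ z ∷ [])) →
    ((∃ λ b → b ∈ W × E y b × b ≢ x × b ≢ z) ⊎ (∀ {v} → v ∈ W → E y v → v ∈ₗ x ∷ z ∷ [])) →
    LargeIndependent C W
  triangle (inj₂ only) _ =
    extend-by-one C xyz x∈ 1st (λ v∈ xv → there (only v∈ xv)) ≤-refl (recurse xyz x∈ 1st)
  triangle (inj₁ _) (inj₂ only) =
    extend-by-one C (y ∷ x ∷ z ∷ []) y∈ 1st (λ v∈ yv → there (only v∈ yv)) ≤-refl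
      (recurse (y ∷ x ∷ z ∷ []) y∈ 1st)
  triangle (inj₁ (a , a∈ , xa , a≢y , a≢z)) (inj₁ (b , b∈ , yb , b≢x , b≢z)) with a ≟ᶠ b
  ... | no a≢b = distinct a∈ b∈ xa yb a≢y a≢z b≢x b≢z a≢b
  -- `x` and `y` share their further neighbour `a`, which is not adjacent to `z` because there is no
  -- K₄. Both `z` and `a` are chosen: they share the neighbours `x`, `y` and have at most one more
  -- each, `c` and `d`.
  ... | yes refl with remaining-neighbour C sub z∈ x∈ y∈ (E-sym xz) (E-sym yz) (adjacent⇒≢ C xy)
                    | remaining-neighbour C sub a∈ x∈ y∈ (E-sym xa) (E-sym yb) (adjacent⇒≢ C xy)
  ... | c , z-closed | d , a-closed =
    extend-by-two C xs z∈ a∈ (a≢z ∘ sym) (λ za → free x∈ y∈ z∈ a∈ xy xz xa yz yb za) 3rd 4th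
      z-closed′ a-closed′ ≤-refl (recurse xs x∈ 1st)
    where
    xs = x ∷ y ∷ z ∷ a ∷ c ∷ d ∷ []
    z-closed′ : ∀ {v} → v ∈ W → E z v → v ∈ₗ xs
    z-closed′ v∈ zv with z-closed v∈ zv
    ... | 1st = 1st
    ... | 2nd = 2nd
    ... | 3rd = 5th
    a-closed′ : ∀ {v} → v ∈ W → E a v → v ∈ₗ xs
    a-closed′ v∈ av with a-closed v∈ av
    ... | 1st = 1st
    ... | 2nd = 2nd
    ... | 3rd = 6th

-- Conflicts in a cubic graph

slots-of-list : {A : Set} (xs : List A) → length xs ≡ 3 →
  Σ (Fin 3 → A) λ f → ∀ {x} → x ∈ₗ xs → ∃ λ i → f i ≡ x
slots-of-list (a ∷ b ∷ c ∷ []) refl =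
  lookup (a ∷ b ∷ c ∷ []) , λ x∈ → index x∈ , sym (lookup-index x∈)

⟦⟧-× : {P Q : Set} (d : Dec P) (e : Dec Q) → ⟦ d ×-dec e ⟧ ≡ ⟦ e ⟧ * ⟦ d ⟧
⟦⟧-× (yes _) (yes _) = refl
⟦⟧-× (yes _) (no _) = refl
⟦⟧-× (no _) (yes _) = refl
⟦⟧-× (no _) (no _) = refl

⟦⟧-split : {P Q R : Set} (d : Dec P) (e : Dec Q) (f : Dec R) → (P → Q → ¬ R) → (P → ¬ Q → R) →
  ⟦ d ×-dec e ⟧ + ⟦ d ×-dec f ⟧ ≡ ⟦ d ⟧
⟦⟧-split (no _) e f not-both one = refl
⟦⟧-split (yes p) (yes q) (yes r) not-both one = contradiction r (not-both p q)
⟦⟧-split (yes p) (yes q) (no ¬r) not-both one = refl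
⟦⟧-split (yes p) (no ¬q) (yes r) not-both one = refl
⟦⟧-split (yes p) (no ¬q) (no ¬r) not-both one = contradiction (one p ¬q) ¬r

module _ {n : ℕ} (G : Graph n) where

  Adj? : ∀ u v → Dec (Adj G u v)
  Adj? u v = T? (adj G u v)

  Adj-sym : ∀ {u v} → Adj G u v → Adj G v u
  Adj-sym {u} {v} = subst T (adj-sym G u v)

  -- Inside one colour class, the independent sets of `conflict ⊤` are exactly the packings, as
  -- vertices of equal colour are not adjacent. A smaller `Z` records only the common neighbours in
  -- `Z`.
  conflict : Subset n → SimpleGraph n
  conflict Z = record
    { E = λ u v → u ≢ v × ∃ λ a → a ∈ Z × Adj G a u × Adj G a v
    ; E? = λ u v → ¬? (u ≟ᶠ v) ×-dec any? (λ a → (a ∈? Z) ×-dec Adj? a u ×-dec Adj? a v)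
    ; E-sym = λ (u≢v , a , a∈ , au , av) → u≢v ∘ sym , a , a∈ , av , au
    ; E-irr = λ (v≢v , _) → v≢v refl }

  Dominated : Subset n → Fin n → Set
  Dominated X v = v ∈ X ⊎ ∃ λ u → u ∈ X × Adj G u v

  Dominated-⊆ : ∀ {X X′ v} → X ⊆ X′ → Dominated X v → Dominated X′ v
  Dominated-⊆ X⊆ (inj₁ v∈) = inj₁ (X⊆ v∈)
  Dominated-⊆ X⊆ (inj₂ (u , u∈ , uv)) = inj₂ (u , X⊆ u∈ , uv)

  neighbours-in : Subset n → Fin n → ℕ
  neighbours-in P a = sum (λ b → ⟦ Adj? a b ×-dec (b ∈? P) ⟧)

  no-neighbours : ∀ P {a} → (∀ {b} → Adj G a b → b ∉ P) → neighbours-in P a ≡ 0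
  no-neighbours P {a} none = sum-zero λ b → ⟦⟧-no (Adj? a b ×-dec (b ∈? P)) λ (ab , b∈) → none ab b∈

  1≤neighbours : ∀ P {a b} → Adj G a b → b ∈ P → 1 ≤ neighbours-in P a
  1≤neighbours P {a} {b} ab b∈ = ≤-trans
    (≤-reflexive (sym (⟦⟧-yes (Adj? a b ×-dec (b ∈? P)) (ab , b∈))))
    (term≤sum (λ b → ⟦ Adj? a b ×-dec (b ∈? P) ⟧) b)

  2≤neighbours : ∀ P {a b b′} → b ≢ b′ → Adj G a b → b ∈ P → Adj G a b′ → b′ ∈ P →
    2 ≤ neighbours-in P a
  2≤neighbours P {a} {b} {b′} b≢b′ ab b∈ ab′ b′∈ = ≤-trans
    (≤-reflexive (sym (cong₂ _+_ (⟦⟧-yes (Adj? a b ×-dec (b ∈? P)) (ab , b∈))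
                                 (⟦⟧-yes (Adj? a b′ ×-dec (b′ ∈? P)) (ab′ , b′∈)))))
    (two-terms≤sum (λ b → ⟦ Adj? a b ×-dec (b ∈? P) ⟧) b≢b′)

  neighbours≤1 : ∀ P {a} → (∀ {b b′} → Adj G a b → b ∈ P → Adj G a b′ → b′ ∈ P → b ≡ b′) →
    neighbours-in P a ≤ 1
  neighbours≤1 P {a} unique = sum-unique≤1 (λ b → Adj? a b ×-dec (b ∈? P))
    λ (ab , b∈) (ab′ , b′∈) → unique ab b∈ ab′ b′∈

  edges-between : ∀ P Q → sum (λ a → ⟦ a ∈? P ⟧ * neighbours-in Q a) ≡
                          sum (λ b → ⟦ b ∈? Q ⟧ * neighbours-in P b)
  edges-between P Q = begin
    sum (λ a → ⟦ a ∈? P ⟧ * sum (λ b → ⟦ Adj? a b ×-dec (b ∈? Q) ⟧))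
      ≡⟨ sum-cong-≗ (λ a → *-distribˡ-sum ⟦ a ∈? P ⟧ (λ b → ⟦ Adj? a b ×-dec (b ∈? Q) ⟧)) ⟩
    sum (λ a → sum (λ b → ⟦ a ∈? P ⟧ * ⟦ Adj? a b ×-dec (b ∈? Q) ⟧))
      ≡⟨ ∑-comm (λ a b → ⟦ a ∈? P ⟧ * ⟦ Adj? a b ×-dec (b ∈? Q) ⟧) ⟩
    sum (λ b → sum (λ a → ⟦ a ∈? P ⟧ * ⟦ Adj? a b ×-dec (b ∈? Q) ⟧))
      ≡⟨ sum-cong-≗ (λ b → sum-cong-≗ (λ a → swap a b)) ⟩
    sum (λ b → sum (λ a → ⟦ b ∈? Q ⟧ * ⟦ Adj? b a ×-dec (a ∈? P) ⟧))
      ≡⟨ sum-cong-≗ (λ b → *-distribˡ-sum ⟦ b ∈? Q ⟧ (λ a → ⟦ Adj? b a ×-dec (a ∈? P) ⟧)) ⟨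
    sum (λ b → ⟦ b ∈? Q ⟧ * neighbours-in P b) ∎
    where
    open ≡-Reasoning
    swap : ∀ a b → ⟦ a ∈? P ⟧ * ⟦ Adj? a b ×-dec (b ∈? Q) ⟧ ≡ ⟦ b ∈? Q ⟧ * ⟦ Adj? b a ×-dec (a ∈? P) ⟧
    swap a b = begin
      p * ⟦ Adj? a b ×-dec (b ∈? Q) ⟧    ≡⟨ cong (p *_) (⟦⟧-× (Adj? a b) (b ∈? Q)) ⟩
      p * (q * ⟦ Adj? a b ⟧)             ≡⟨ *-assoc p q _ ⟨
      p * q * ⟦ Adj? a b ⟧               ≡⟨ cong₂ _*_ (*-comm p q) (⟦⟧-cong (Adj? a b) (Adj? b a) Adj-sym Adj-sym) ⟩
      q * p * ⟦ Adj? b a ⟧               ≡⟨ *-assoc q p _ ⟩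
      q * (p * ⟦ Adj? b a ⟧)             ≡⟨ cong (q *_) (⟦⟧-× (Adj? b a) (a ∈? P)) ⟨
      q * ⟦ Adj? b a ×-dec (a ∈? P) ⟧    ∎
      where
      p = ⟦ a ∈? P ⟧
      q = ⟦ b ∈? Q ⟧

  module _ (cubic : Cubic G) where

    degree-sum : ∀ v → sum (λ u → ⟦ Adj? v u ⟧) ≡ 3
    degree-sum v = trans (sym (length-filter (Adj? v) (λ u → u))) (cubic v)

    has-neighbour : ∀ v → ∃ λ u → Adj G v u
    has-neighbour v with any? (Adj? v)
    ... | yes found = found
    ... | no none with trans (sym (degree-sum v)) (sum-zero λ u → ⟦⟧-no (Adj? v u) λ vu → none (u , vu))
    ... | ()

    neighbour-slots : ∀ v → Σ (Fin 3 → Fin n) λ f → ∀ {u} → Adj G v u → ∃ λ i → f i ≡ u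
    neighbour-slots v with slots-of-list (filter (Adj? v) (allFin n)) (cubic v)
    ... | f , covers = f , λ vu → covers (∈-filter⁺ (Adj? v) (∈-allFin _) vu)

    neighbours-among : ∀ {v a b c u} → Adj G v a → Adj G v b → Adj G v c →
      a ≢ b → a ≢ c → b ≢ c → Adj G v u → u ∈ₗ a ∷ b ∷ c ∷ []
    neighbours-among {v} va vb vc a≢b a≢c b≢c vu =
      fourth-in-three-slots (covers va) (covers vb) (covers vc) (covers vu) a≢b a≢c b≢c
      where
      covers : ∀ {u} → Adj G v u → ∃ λ i → proj₁ (neighbour-slots v) i ≡ u
      covers = proj₂ (neighbour-slots v)

    sum-neighbours-in : ∀ P → sum (neighbours-in P) ≡ 3 * ∣ P ∣
    sum-neighbours-in P = begin
      sum (neighbours-in P)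
        ≡⟨ ∑-comm (λ a b → ⟦ Adj? a b ×-dec (b ∈? P) ⟧) ⟩
      sum (λ b → sum (λ a → ⟦ Adj? a b ×-dec (b ∈? P) ⟧))
        ≡⟨ sum-cong-≗ at ⟩
      sum (λ b → 3 * ⟦ b ∈? P ⟧)
        ≡⟨ *∣∣≡sum 3 P ⟨
      3 * ∣ P ∣ ∎
      where
      open ≡-Reasoning
      at : ∀ b → sum (λ a → ⟦ Adj? a b ×-dec (b ∈? P) ⟧) ≡ 3 * ⟦ b ∈? P ⟧
      at b = begin
        sum (λ a → ⟦ Adj? a b ×-dec (b ∈? P) ⟧)
          ≡⟨ sum-cong-≗ (λ a → trans (⟦⟧-× (Adj? a b) (b ∈? P))
               (cong (⟦ b ∈? P ⟧ *_) (⟦⟧-cong (Adj? a b) (Adj? b a) Adj-sym Adj-sym))) ⟩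
        sum (λ a → ⟦ b ∈? P ⟧ * ⟦ Adj? b a ⟧)
          ≡⟨ *-distribˡ-sum ⟦ b ∈? P ⟧ (λ a → ⟦ Adj? b a ⟧) ⟨
        ⟦ b ∈? P ⟧ * sum (λ a → ⟦ Adj? b a ⟧)
          ≡⟨ cong (⟦ b ∈? P ⟧ *_) (degree-sum b) ⟩
        ⟦ b ∈? P ⟧ * 3
          ≡⟨ *-comm ⟦ b ∈? P ⟧ 3 ⟩
        3 * ⟦ b ∈? P ⟧ ∎

    module _ (R : Subset n) (at-most-two : ∀ {a b b′ b″} → b ∈ R → b′ ∈ R → b″ ∈ R →
               Adj G a b → Adj G a b′ → Adj G a b″ → b ≢ b′ → b ≢ b″ → b′ ≡ b″) where

      open SimpleGraph (conflict ⊤)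

      private
        partner? : ∀ a b → Dec (∃ λ b′ → b′ ∈ R × Adj G a b′ × b ≢ b′)
        partner? a b = any? (λ b′ → (b′ ∈? R) ×-dec Adj? a b′ ×-dec ¬? (b ≟ᶠ b′))

        -- If `a` has no second neighbour in `R`, the slot is filled with `b` itself; a spare slot
        -- may hold anything.
        partner-of : ∀ {a b} → Dec (∃ λ b′ → b′ ∈ R × Adj G a b′ × b ≢ b′) → Fin n
        partner-of {b = b} (no _) = b
        partner-of (yes (b′ , _)) = b′

        partner-unique : ∀ {a b b′} (d : Dec (∃ λ b′ → b′ ∈ R × Adj G a b′ × b ≢ b′)) → b ∈ R → b′ ∈ R →
          Adj G a b → Adj G a b′ → b ≢ b′ → partner-of {a} {b} d ≡ b′
        partner-unique (no none) b∈ b′∈ ab ab′ b≢b′ = contradiction (_ , b′∈ , ab′ , b≢b′) none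
        partner-unique (yes (b″ , b″∈ , ab″ , b≢b″)) b∈ b′∈ ab ab′ b≢b′ =
          at-most-two b∈ b″∈ b′∈ ab ab″ ab′ b≢b″ b≢b′

      -- A conflict of `b` passes through one of its three neighbours, and each of these has at most
      -- one further neighbour in `R`.
      conflict-subcubic : Subcubic (conflict ⊤) R
      conflict-subcubic = record
        { slot = λ b i → partner-of (partner? (proj₁ (neighbour-slots b) i) b)
        ; covers = covers }
        where
        covers : ∀ {b b′} → b ∈ R → b′ ∈ R → E b b′ →
          ∃ λ i → partner-of (partner? (proj₁ (neighbour-slots b) i) b) ≡ b′
        covers {b} b∈ b′∈ (b≢b′ , a , _ , ab , ab′) with proj₂ (neighbour-slots b) (Adj-sym ab)
        ... | i , refl = i , partner-unique (partner? _ b) b∈ b′∈ ab ab′ b≢b′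

      -- Three vertices dominate a K₄ of conflicts b₁, …, b₄ together with all its neighbours: b₁, b₂ and
      -- the common neighbour of b₃ and b₄. Each K₄ thus saves one vertex, exactly what it costs in the
      -- independent-set bound.
      pack-and-cover-within : ∀ k W → ∣ W ∣ ≤ k → W ⊆ R →
        ∃ λ I → ∃ λ D → IndependentIn W I × ∣ D ∣ ≤ ∣ W ∣ × ∣ D ∣ ≤ 3 * ∣ I ∣ ×
          (∀ {b} → b ∈ W → Dominated D b) × (∀ {a b} → b ∈ W → Adj G a b → Dominated D a)
      pack-and-cover-within k W W≤k W⊆R
        with any? (λ b₁ → any? (λ b₂ → any? (λ b₃ → any? (λ b₄ →
               (b₁ ∈? W) ×-dec (b₂ ∈? W) ×-dec (b₃ ∈? W) ×-dec (b₄ ∈? W) ×-dec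
               E? b₁ b₂ ×-dec E? b₁ b₃ ×-dec E? b₁ b₄ ×-dec E? b₂ b₃ ×-dec E? b₂ b₄ ×-dec E? b₃ b₄))))
      ... | no none with subcubic-independent ∣ W ∣ (conflict ⊤) W ≤-refl
              (Subcubic-⊆ (conflict ⊤) W⊆R conflict-subcubic)
              (λ {b₁} {b₂} {b₃} {b₄} b₁∈ b₂∈ b₃∈ b₄∈ e₁₂ e₁₃ e₁₄ e₂₃ e₂₄ e₃₄ →
                none (b₁ , b₂ , b₃ , b₄ , b₁∈ , b₂∈ , b₃∈ , b₄∈ , e₁₂ , e₁₃ , e₁₄ , e₂₃ , e₂₄ , e₃₄))
      ... | I , indepIn , bound =
        -- Without a K₄, `W` itself serves as the dominating set, and the independent-set bound is
        -- the bound on its size.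
        I , W , indepIn , ≤-refl , bound , inj₁ , λ b∈ ab → inj₂ (_ , b∈ , Adj-sym ab)
      pack-and-cover-within zero W W≤k W⊆R | yes (b₁ , _ , _ , _ , b₁∈ , _) =
        contradiction (≤-<-trans z≤n (without< W (b₁ ∷ []) b₁∈ 1st)) (≤⇒≯ W≤k)
      pack-and-cover-within (suc k) W W≤k W⊆R
        | yes (b₁ , b₂ , b₃ , b₄ , b₁∈ , b₂∈ , b₃∈ , b₄∈ ,
               e₁₂@(b₁≢b₂ , a₁₂ , _ , a₁₂b₁ , a₁₂b₂) , e₁₃@(b₁≢b₃ , a₁₃ , _ , a₁₃b₁ , a₁₃b₃) ,
               e₁₄@(b₁≢b₄ , a₁₄ , _ , a₁₄b₁ , a₁₄b₄) , e₂₃@(b₂≢b₃ , a₂₃ , _ , a₂₃b₂ , a₂₃b₃) ,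
               e₂₄@(b₂≢b₄ , a₂₄ , _ , a₂₄b₂ , a₂₄b₄) , e₃₄@(b₃≢b₄ , a₃₄ , _ , a₃₄b₃ , a₃₄b₄))
        = I ∪ ⁅ b₁ ⁆ , D , insert-independentIn (W′⊆W ∘ proj₁ indepIn , proj₂ indepIn) b₁∈ b₁-free ,
          D≤W , D≤3I , covers-W , covers-N
        where
        xs = b₁ ∷ b₂ ∷ b₃ ∷ b₄ ∷ []
        W′ = without W xs
        W′⊆W : W′ ⊆ W
        W′⊆W = proj₁ ∘ ∈-without⁻ W xs
        rec = pack-and-cover-within k W′ (≤-pred (≤-trans (without< W xs b₁∈ 1st) W≤k)) (W⊆R ∘ W′⊆W)
        I = proj₁ rec
        D′ = proj₁ (proj₂ rec)
        indepIn : IndependentIn W′ I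
        indepIn = proj₁ (proj₂ (proj₂ rec))
        D′≤W′ : ∣ D′ ∣ ≤ ∣ W′ ∣
        D′≤W′ = proj₁ (proj₂ (proj₂ (proj₂ rec)))
        D′≤3I : ∣ D′ ∣ ≤ 3 * ∣ I ∣
        D′≤3I = proj₁ (proj₂ (proj₂ (proj₂ (proj₂ rec))))
        D′-W′ : ∀ {b} → b ∈ W′ → Dominated D′ b
        D′-W′ = proj₁ (proj₂ (proj₂ (proj₂ (proj₂ (proj₂ rec)))))
        D′-N : ∀ {a b} → b ∈ W′ → Adj G a b → Dominated D′ a
        D′-N = proj₂ (proj₂ (proj₂ (proj₂ (proj₂ (proj₂ rec)))))

        ∉xs : ∀ {v} → v ∈ I → ¬ v ∈ₗ xs
        ∉xs = proj₂ ∘ ∈-without⁻ W xs ∘ proj₁ indepIn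
        -- The conflicts with `b₂`, `b₃`, `b₄` exhaust the three possible for `b₁`, so it has none
        -- with the vertices that remain.
        b₁-free : ∀ {v} → v ∈ I → ¬ E b₁ v
        b₁-free v∈ b₁v = ∉xs v∈ (there (neighbours-of (conflict ⊤)
          (Subcubic-⊆ (conflict ⊤) W⊆R conflict-subcubic)
          b₁∈ b₂∈ b₃∈ b₄∈ e₁₂ e₁₃ e₁₄ b₂≢b₃ b₂≢b₄ b₃≢b₄ (W′⊆W (proj₁ indepIn v∈)) b₁v))

        new = ⁅ b₁ ⁆ ∪ ⁅ b₂ ⁆ ∪ ⁅ a₃₄ ⁆
        D = D′ ∪ new
        D′⊆D : D′ ⊆ D
        D′⊆D = p⊆p∪q new
        b₁∈D : b₁ ∈ D
        b₁∈D = q⊆p∪q D′ new (p⊆p∪q _ (x∈⁅x⁆ b₁))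
        b₂∈D : b₂ ∈ D
        b₂∈D = q⊆p∪q D′ new (q⊆p∪q ⁅ b₁ ⁆ _ (p⊆p∪q _ (x∈⁅x⁆ b₂)))
        a₃₄∈D : a₃₄ ∈ D
        a₃₄∈D = q⊆p∪q D′ new (q⊆p∪q ⁅ b₁ ⁆ _ (q⊆p∪q ⁅ b₂ ⁆ _ (x∈⁅x⁆ a₃₄)))

        D-split : ∀ {v} → v ∈ D → v ∈ D′ ⊎ v ∈ₗ b₁ ∷ b₂ ∷ a₃₄ ∷ []
        D-split v∈ with x∈p∪q⁻ D′ new v∈
        ... | inj₁ v∈D′ = inj₁ v∈D′
        ... | inj₂ v∈new with x∈p∪q⁻ ⁅ b₁ ⁆ _ v∈new
        ... | inj₁ v∈ = inj₂ (here (x∈⁅y⁆⇒x≡y b₁ v∈))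
        ... | inj₂ v∈rest with x∈p∪q⁻ ⁅ b₂ ⁆ _ v∈rest
        ... | inj₁ v∈ = inj₂ (there (here (x∈⁅y⁆⇒x≡y b₂ v∈)))
        ... | inj₂ v∈ = inj₂ (there (there (here (x∈⁅y⁆⇒x≡y a₃₄ v∈))))
        D≤3+D′ : ∣ D ∣ ≤ 3 + ∣ D′ ∣
        D≤3+D′ = cover≤ (b₁ ∷ b₂ ∷ a₃₄ ∷ []) D-split

        -- `W` loses four vertices, but `D` grows by at most three, so three of the four suffice.
        3+W′≤W : 3 + ∣ W′ ∣ ≤ ∣ W ∣
        3+W′≤W = ≤-trans (s≤s (s≤s (insert< b₁∉))) (≤-trans (s≤s (insert< b₂∉))
          (≤-trans (insert< b₃∉) (p⊆q⇒∣p∣≤∣q∣ inW)))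
          where
          W₁ = W′ ∪ ⁅ b₁ ⁆
          W₂ = W₁ ∪ ⁅ b₂ ⁆
          b₁∉ : b₁ ∉ W′
          b₁∉ b∈ = proj₂ (∈-without⁻ W xs b∈) 1st
          b₂∉ : b₂ ∉ W₁
          b₂∉ b∈ = [ (λ b∈W′ → proj₂ (∈-without⁻ W xs b∈W′) 2nd) , b₁≢b₂ ∘ sym ]′ (∈-insert⁻ W′ b∈)
          b₃∉ : b₃ ∉ W₂
          b₃∉ b∈ = [ (λ b∈W₁ → [ (λ b∈W′ → proj₂ (∈-without⁻ W xs b∈W′) 3rd) , b₁≢b₃ ∘ sym ]′
                                 (∈-insert⁻ W′ b∈W₁))
                   , b₂≢b₃ ∘ sym ]′ (∈-insert⁻ W₁ b∈)
          inW : W₂ ∪ ⁅ b₃ ⁆ ⊆ W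
          inW v∈ with ∈-insert⁻ W₂ v∈
          ... | inj₂ refl = b₃∈
          ... | inj₁ v∈W₂ with ∈-insert⁻ W₁ v∈W₂
          ... | inj₂ refl = b₂∈
          ... | inj₁ v∈W₁ with ∈-insert⁻ W′ v∈W₁
          ... | inj₂ refl = b₁∈
          ... | inj₁ v∈W′ = W′⊆W v∈W′

        D≤W : ∣ D ∣ ≤ ∣ W ∣
        D≤W = ≤-trans D≤3+D′ (≤-trans (+-monoʳ-≤ 3 D′≤W′) 3+W′≤W)
        D≤3I : ∣ D ∣ ≤ 3 * ∣ I ∪ ⁅ b₁ ⁆ ∣
        D≤3I = *-three-suc D≤3+D′ D′≤3I (insert< λ b₁∈I → ∉xs b₁∈I 1st)

        covers-W : ∀ {b} → b ∈ W → Dominated D b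
        covers-W {b} b∈ with mem? _≟ᶠ_ b xs
        ... | no b∉xs = Dominated-⊆ D′⊆D (D′-W′ (∈-without⁺ W xs b∈ b∉xs))
        ... | yes 1st = inj₁ b₁∈D
        ... | yes 2nd = inj₁ b₂∈D
        ... | yes 3rd = inj₂ (a₃₄ , a₃₄∈D , a₃₄b₃)
        ... | yes 4th = inj₂ (a₃₄ , a₃₄∈D , a₃₄b₄)

        -- If `a` and `a′` coincided, this vertex would have three neighbours in `R`. Hence
        -- different pairs of the K₄ have different common neighbours.
        not-three : ∀ {b b′ b″ a a′} → b ∈ W → b′ ∈ W → b″ ∈ W → b ≢ b′ → b ≢ b″ → b′ ≢ b″ →
          Adj G a b → Adj G a b′ → Adj G a′ b″ → a ≢ a′
        not-three b∈ b′∈ b″∈ b≢b′ b≢b″ b′≢b″ ab ab′ ab″ refl =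
          b′≢b″ (at-most-two (W⊆R b∈) (W⊆R b′∈) (W⊆R b″∈) ab ab′ ab″ b≢b′ b≢b″)

        covers-N : ∀ {a b} → b ∈ W → Adj G a b → Dominated D a
        covers-N {a} {b} b∈ ab with mem? _≟ᶠ_ b xs
        ... | no b∉xs = Dominated-⊆ D′⊆D (D′-N (∈-without⁺ W xs b∈ b∉xs) ab)
        ... | yes 1st = inj₂ (b₁ , b₁∈D , Adj-sym ab)
        ... | yes 2nd = inj₂ (b₂ , b₂∈D , Adj-sym ab)
        -- The common neighbours of `b₃` with `b₁`, `b₂` and `b₄` are distinct, hence all its
        -- neighbours: the first two are dominated by `b₁` and `b₂`, the last is `a₃₄`.
        ... | yes 3rd with neighbours-among (Adj-sym a₁₃b₃) (Adj-sym a₂₃b₃) (Adj-sym a₃₄b₃)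
          (not-three b₁∈ b₃∈ b₂∈ b₁≢b₃ b₁≢b₂ (b₂≢b₃ ∘ sym) a₁₃b₁ a₁₃b₃ a₂₃b₂)
          (not-three b₁∈ b₃∈ b₄∈ b₁≢b₃ b₁≢b₄ b₃≢b₄ a₁₃b₁ a₁₃b₃ a₃₄b₄)
          (not-three b₂∈ b₃∈ b₄∈ b₂≢b₃ b₂≢b₄ b₃≢b₄ a₂₃b₂ a₂₃b₃ a₃₄b₄)
          (Adj-sym ab)
        ... | 1st = inj₂ (b₁ , b₁∈D , Adj-sym a₁₃b₁)
        ... | 2nd = inj₂ (b₂ , b₂∈D , Adj-sym a₂₃b₂)
        ... | 3rd = inj₁ a₃₄∈D
        covers-N {a} {b} b∈ ab | yes 4th with neighbours-among
          (Adj-sym a₁₄b₄) (Adj-sym a₂₄b₄) (Adj-sym a₃₄b₄)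
          (not-three b₁∈ b₄∈ b₂∈ b₁≢b₄ b₁≢b₂ (b₂≢b₄ ∘ sym) a₁₄b₁ a₁₄b₄ a₂₄b₂)
          (not-three b₁∈ b₄∈ b₃∈ b₁≢b₄ b₁≢b₃ (b₃≢b₄ ∘ sym) a₁₄b₁ a₁₄b₄ a₃₄b₃)
          (not-three b₂∈ b₄∈ b₃∈ b₂≢b₄ b₂≢b₃ (b₃≢b₄ ∘ sym) a₂₄b₂ a₂₄b₄ a₃₄b₃)
          (Adj-sym ab)
        ... | 1st = inj₂ (b₁ , b₁∈D , Adj-sym a₁₄b₁)
        ... | 2nd = inj₂ (b₂ , b₂∈D , Adj-sym a₂₄b₂)
        ... | 3rd = inj₁ a₃₄∈D

      abstract
        pack-and-cover : ∃ λ I → ∃ λ D → IndependentIn R I × ∣ D ∣ ≤ ∣ R ∣ × ∣ D ∣ ≤ 3 * ∣ I ∣ ×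
          (∀ {b} → b ∈ R → Dominated D b) × (∀ {a b} → b ∈ R → Adj G a b → Dominated D a)
        pack-and-cover = pack-and-cover-within ∣ R ∣ R ≤-refl (λ b∈ → b∈)

-- Domination and packing

-- Three times the claim, with `6 * s` added to both sides, is the sum of `edges`, 3 times `d ≤ r`,
-- 12 times `d ≤ 3 * t`, 9 times `q ≤ 3 * s`, 3 times `uncovered` and 6 times `matched`, up to terms
-- common to both sides. The added `6 * s` is the one on the left of `edges`.
cost-bound : ∀ s d r t q a m u → d ≤ r → d ≤ 3 * t → q ≤ 3 * s →
  3 * r + (6 * s + 6 * a) ≤ 2 * (3 * q) → 3 * u + m ≤ q → u + 2 * m ≤ a →
  5 * (s + d + m + u) ≤ 12 * (s + t)
cost-bound s d r t q a m u d≤r d≤3t q≤3s edges uncovered matched =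
  *-cancelˡ-≤ 3 (+-cancelʳ-≤ (6 * s) _ _ (begin
    3 * (5 * (s + d + m + u)) + 6 * s
      ≡⟨ solve 4 (λ s d m u →
           con 3 :* (con 5 :* (s :+ d :+ m :+ u)) :+ con 6 :* s :=
           con 15 :* s :+ con 12 :* d :+ (con 3 :* d :+ con 6 :* s :+ con 6 :* (u :+ con 2 :* m))
             :+ con 3 :* (con 3 :* u :+ m)) refl s d m u ⟩
    15 * s + 12 * d + (3 * d + 6 * s + 6 * (u + 2 * m)) + 3 * (3 * u + m)
      ≤⟨ +-mono-≤ (+-monoʳ-≤ (15 * s + 12 * d)
           (+-mono-≤ (+-monoˡ-≤ (6 * s) (*-monoʳ-≤ 3 d≤r)) (*-monoʳ-≤ 6 matched)))
           (*-monoʳ-≤ 3 uncovered) ⟩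
    15 * s + 12 * d + (3 * r + 6 * s + 6 * a) + 3 * q
      ≤⟨ +-monoˡ-≤ (3 * q) (+-monoʳ-≤ (15 * s + 12 * d)
           (≤-trans (≤-reflexive (+-assoc (3 * r) (6 * s) (6 * a))) edges)) ⟩
    15 * s + 12 * d + 2 * (3 * q) + 3 * q
      ≡⟨ solve 3 (λ s d q → con 15 :* s :+ con 12 :* d :+ con 2 :* (con 3 :* q) :+ con 3 :* q :=
                            con 15 :* s :+ con 12 :* d :+ con 9 :* q) refl s d q ⟩
    15 * s + 12 * d + 9 * q
      ≤⟨ +-mono-≤ (+-monoʳ-≤ (15 * s) (*-monoʳ-≤ 12 d≤3t)) (*-monoʳ-≤ 9 q≤3s) ⟩
    15 * s + 12 * (3 * t) + 9 * (3 * s)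
      ≡⟨ solve 2 (λ s t → con 15 :* s :+ con 12 :* (con 3 :* t) :+ con 9 :* (con 3 :* s) :=
                          con 3 :* (con 12 :* (s :+ t)) :+ con 6 :* s) refl s t ⟩
    3 * (12 * (s + t)) + 6 * s ∎))
  where
  open ≤-Reasoning
  open +-*-Solver

-- The sets of the construction

module _ {n : ℕ} (G : Graph n) (bipartite : Bipartite G) (cubic : Cubic G) where

  private
    colour : Fin n → Bool
    colour = proj₁ bipartite

    same-colour : ∀ {u v} → colour u ≡ colour v → ¬ Adj G u v
    same-colour {u} {v} eq uv = proj₂ bipartite u v uv eq

    to-B : ∀ {a b} → colour a ≡ true → Adj G a b → colour b ≡ false
    to-B {a} {b} ca ab with colour b in eq
    ... | false = refl
    ... | true = contradiction ab (same-colour (trans ca (sym eq)))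

    to-A : ∀ {a b} → colour b ≡ false → Adj G a b → colour a ≡ true
    to-A {a} {b} cb ab with colour a in eq
    ... | true = refl
    ... | false = contradiction ab (same-colour (trans eq (sym cb)))

    true≢false : ∀ {v} → colour v ≡ true → colour v ≢ false
    true≢false eq eq′ with trans (sym eq) eq′
    ... | ()

    A? : ∀ v → Dec (colour v ≡ true)
    A? v = colour v ≟ true

    abstract
      S : Subset n
      S = proj₁ (SimpleGraph.maximal-independent (conflict G ⊤) (comprehension A?))
      S⊆A : ∀ {v} → v ∈ S → colour v ≡ true
      S⊆A v∈ = ∈-comprehension⁻ A?
        (proj₁ (proj₁ (proj₂ (SimpleGraph.maximal-independent (conflict G ⊤) (comprehension A?)))) v∈)
      S-independent : SimpleGraph.Independent (conflict G ⊤) S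
      S-independent =
        proj₂ (proj₁ (proj₂ (SimpleGraph.maximal-independent (conflict G ⊤) (comprehension A?))))
      S-blocks : ∀ {v} → colour v ≡ true → v ∉ S → ∃ λ u → u ∈ S × SimpleGraph.E (conflict G ⊤) v u
      S-blocks cv = proj₂ (proj₂ (SimpleGraph.maximal-independent (conflict G ⊤) (comprehension A?)))
        (∈-comprehension⁺ A? cv)

    Q? : ∀ b → Dec (∃ λ a → a ∈ S × Adj G a b)
    Q? b = any? (λ a → (a ∈? S) ×-dec Adj? G a b)

    abstract
      Q : Subset n
      Q = comprehension Q?
      ∈Q⁻ : ∀ {b} → b ∈ Q → ∃ λ a → a ∈ S × Adj G a b
      ∈Q⁻ = ∈-comprehension⁻ Q?
      ∈Q⁺ : ∀ {a b} → a ∈ S → Adj G a b → b ∈ Q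
      ∈Q⁺ a∈ ab = ∈-comprehension⁺ Q? (_ , a∈ , ab)

    Q-neighbour : ∀ {a} → colour a ≡ true → ∃ λ b → b ∈ Q × Adj G a b
    Q-neighbour {a} ca with a ∈? S
    ... | yes a∈S with has-neighbour G cubic a
    ... | b , ab = b , ∈Q⁺ a∈S ab , ab
    Q-neighbour {a} ca | no a∉S
      with S-blocks ca a∉S
    ... | s , s∈ , _ , b , _ , ba , bs = b , ∈Q⁺ s∈ (Adj-sym G bs) , Adj-sym G ba

    R? : ∀ b → Dec (colour b ≡ false × b ∉ Q)
    R? b = (colour b ≟ false) ×-dec ¬? (b ∈? Q)

    abstract
      R : Subset n
      R = comprehension R?
      ∈R⁻ : ∀ {b} → b ∈ R → colour b ≡ false × b ∉ Q
      ∈R⁻ = ∈-comprehension⁻ R?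
      ∈R⁺ : ∀ {b} → colour b ≡ false → b ∉ Q → b ∈ R
      ∈R⁺ cb b∉Q = ∈-comprehension⁺ R? (cb , b∉Q)

    Q-or-R : ∀ {a b} → colour a ≡ true → Adj G a b → b ∉ R → b ∈ Q
    Q-or-R {b = b} ca ab b∉R with b ∈? Q
    ... | yes b∈Q = b∈Q
    ... | no b∉Q = contradiction (∈R⁺ (to-B ca ab) b∉Q) b∉R

    -- Three neighbours in `R` would exhaust the neighbourhood of `a` and leave no place for its
    -- neighbour in `Q`.
    R-at-most-two : ∀ {a b b′ b″} → b ∈ R → b′ ∈ R → b″ ∈ R →
      Adj G a b → Adj G a b′ → Adj G a b″ → b ≢ b′ → b ≢ b″ → b′ ≡ b″
    R-at-most-two {b′ = b′} {b″} b∈ b′∈ b″∈ ab ab′ ab″ b≢b′ b≢b″ with b′ ≟ᶠ b″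
    ... | yes eq = eq
    ... | no b′≢b″ with Q-neighbour (to-A (proj₁ (∈R⁻ b∈)) ab)
    ... | q , q∈ , aq with neighbours-among G cubic ab ab′ ab″ b≢b′ b≢b″ b′≢b″ aq
    ... | 1st = contradiction q∈ (proj₂ (∈R⁻ b∈))
    ... | 2nd = contradiction q∈ (proj₂ (∈R⁻ b′∈))
    ... | 3rd = contradiction q∈ (proj₂ (∈R⁻ b″∈))

    cover = pack-and-cover G cubic R R-at-most-two
    I = proj₁ cover
    D = proj₁ (proj₂ cover)
    I-independent : SimpleGraph.IndependentIn (conflict G ⊤) R I
    I-independent = proj₁ (proj₂ (proj₂ cover))
    D≤R : ∣ D ∣ ≤ ∣ R ∣
    D≤R = proj₁ (proj₂ (proj₂ (proj₂ cover)))
    D≤3I : ∣ D ∣ ≤ 3 * ∣ I ∣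
    D≤3I = proj₁ (proj₂ (proj₂ (proj₂ (proj₂ cover))))
    D-dominates-R : ∀ {b} → b ∈ R → Dominated G D b
    D-dominates-R = proj₁ (proj₂ (proj₂ (proj₂ (proj₂ (proj₂ cover)))))
    D-dominates-N : ∀ {a b} → b ∈ R → Adj G a b → Dominated G D a
    D-dominates-N = proj₂ (proj₂ (proj₂ (proj₂ (proj₂ (proj₂ cover)))))

    A₀? : ∀ a → Dec (colour a ≡ true × a ∉ S × (∀ b → Adj G a b → b ∉ R))
    A₀? a = A? a ×-dec ¬? (a ∈? S) ×-dec all? (λ b → Adj? G a b →-dec ¬? (b ∈? R))

    abstract
      A₀ : Subset n
      A₀ = comprehension A₀?
      ∈A₀⁻ : ∀ {a} → a ∈ A₀ → colour a ≡ true × a ∉ S × (∀ b → Adj G a b → b ∉ R)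
      ∈A₀⁻ = ∈-comprehension⁻ A₀?
      ∈A₀⁺ : ∀ {a} → colour a ≡ true → a ∉ S → (∀ b → Adj G a b → b ∉ R) → a ∈ A₀
      ∈A₀⁺ ca a∉S no-R = ∈-comprehension⁺ A₀? (ca , a∉S , no-R)

    A₀-to-Q : ∀ {a b} → a ∈ A₀ → Adj G a b → b ∈ Q
    A₀-to-Q a∈ ab = Q-or-R (proj₁ (∈A₀⁻ a∈)) ab (proj₂ (proj₂ (∈A₀⁻ a∈)) _ ab)

    TwoEnds : Fin n → Set
    TwoEnds b = b ∈ Q × ∃ λ a → ∃ λ a′ → a ≢ a′ × (Adj G b a × a ∈ A₀) × (Adj G b a′ × a′ ∈ A₀)
    two-ends? : ∀ b → Dec (TwoEnds b)
    two-ends? b = (b ∈? Q) ×-dec any? (λ a → any? (λ a′ → ¬? (a ≟ᶠ a′) ×-dec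
      (Adj? G b a ×-dec (a ∈? A₀)) ×-dec (Adj? G b a′ ×-dec (a′ ∈? A₀))))

    abstract
      -- Only conflicts at vertices of `A₀` count. A vertex with two ends left out of `M` then
      -- shares a vertex of `A₀` with a member of `M`, and not merely its neighbour in `S`.
      M : Subset n
      M = proj₁ (SimpleGraph.maximal-independent (conflict G A₀) (comprehension two-ends?))
      ∈M⁻ : ∀ {b} → b ∈ M → TwoEnds b
      ∈M⁻ b∈ = ∈-comprehension⁻ two-ends?
        (proj₁ (proj₁ (proj₂ (SimpleGraph.maximal-independent (conflict G A₀) (comprehension two-ends?)))) b∈)
      M-independent : SimpleGraph.Independent (conflict G A₀) M
      M-independent =
        proj₂ (proj₁ (proj₂ (SimpleGraph.maximal-independent (conflict G A₀) (comprehension two-ends?))))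
      M-blocks : ∀ {b} → TwoEnds b → b ∉ M → ∃ λ m → m ∈ M × SimpleGraph.E (conflict G A₀) b m
      M-blocks ends =
        proj₂ (proj₂ (SimpleGraph.maximal-independent (conflict G A₀) (comprehension two-ends?)))
          (∈-comprehension⁺ two-ends? ends)

    U? : ∀ a → Dec (a ∈ A₀ × ¬ ∃ λ b → b ∈ M × Adj G b a)
    U? a = (a ∈? A₀) ×-dec ¬? (any? λ b → (b ∈? M) ×-dec Adj? G b a)

    abstract
      U : Subset n
      U = comprehension U?
      ∈U⁻ : ∀ {a} → a ∈ U → a ∈ A₀ × ¬ ∃ λ b → b ∈ M × Adj G b a
      ∈U⁻ = ∈-comprehension⁻ U?
      ∈U⁺ : ∀ {a} → a ∈ A₀ → (¬ ∃ λ b → b ∈ M × Adj G b a) → a ∈ U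
      ∈U⁺ a∈A₀ free = ∈-comprehension⁺ U? (a∈A₀ , free)

    -- The edge counts

    N : Subset n → Fin n → ℕ
    N = neighbours-in G

    Q≤3S : ∣ Q ∣ ≤ 3 * ∣ S ∣
    Q≤3S = begin
      ∣ Q ∣                                ≡⟨ ∣∣≡sum Q ⟩
      sum (λ b → ⟦ b ∈? Q ⟧)               ≤⟨ sum-mono at ⟩
      sum (N S)                            ≡⟨ sum-neighbours-in G cubic S ⟩
      3 * ∣ S ∣                            ∎
      where
      open ≤-Reasoning
      at : ∀ b → ⟦ b ∈? Q ⟧ ≤ N S b
      at b with b ∈? Q
      ... | no _ = z≤n
      ... | yes b∈Q with ∈Q⁻ b∈Q
      ... | a , a∈ , ab = 1≤neighbours G S (Adj-sym G ab) a∈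

    N-Q+N-R : ∀ {a} → colour a ≡ true → N R a + N Q a ≡ 3
    N-Q+N-R {a} ca = trans
      (sym (∑-distrib-+ (λ b → ⟦ Adj? G a b ×-dec (b ∈? R) ⟧) (λ b → ⟦ Adj? G a b ×-dec (b ∈? Q) ⟧)))
      (trans (sum-cong-≗ at) (degree-sum G cubic a))
      where
      at : ∀ b → ⟦ Adj? G a b ×-dec (b ∈? R) ⟧ + ⟦ Adj? G a b ×-dec (b ∈? Q) ⟧ ≡ ⟦ Adj? G a b ⟧
      at b = ⟦⟧-split (Adj? G a b) (b ∈? R) (b ∈? Q) (λ _ → proj₂ ∘ ∈R⁻) (Q-or-R ca)

    -- A vertex of `A` has r neighbours in `R` and q ≥ 1 in `Q` with r + q = 3, so r ≤ 2q. On `S`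
    -- and `A₀`, where r = 0 and q = 3, the slack is 6. Vertices outside `A` contribute nothing on
    -- the left.
    edge-count : 3 * ∣ R ∣ + (6 * ∣ S ∣ + 6 * ∣ A₀ ∣) ≤ 2 * (3 * ∣ Q ∣)
    edge-count = begin
      3 * ∣ R ∣ + (6 * ∣ S ∣ + 6 * ∣ A₀ ∣)
        ≡⟨ cong₂ _+_ (sym (sum-neighbours-in G cubic R)) (cong₂ _+_ (*∣∣≡sum 6 S) (*∣∣≡sum 6 A₀)) ⟩
      sum (N R) + (sum s + sum a₀)
        ≡⟨ cong (sum (N R) +_) (∑-distrib-+ s a₀) ⟨
      sum (N R) + sum (λ a → s a + a₀ a)
        ≡⟨ ∑-distrib-+ (N R) (λ a → s a + a₀ a) ⟨
      sum (λ a → N R a + (s a + a₀ a))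
        ≤⟨ sum-mono at ⟩
      sum (λ a → 2 * N Q a)
        ≡⟨ *-distribˡ-sum 2 (N Q) ⟨
      2 * sum (N Q)
        ≡⟨ cong (2 *_) (sum-neighbours-in G cubic Q) ⟩
      2 * (3 * ∣ Q ∣) ∎
      where
      open ≤-Reasoning
      s a₀ : Fin n → ℕ
      s a = 6 * ⟦ a ∈? S ⟧
      a₀ a = 6 * ⟦ a ∈? A₀ ⟧
      all-in-Q : ∀ {a} → colour a ≡ true → (∀ {b} → Adj G a b → b ∉ R) → N R a + 6 ≤ 2 * N Q a
      all-in-Q {a} ca none with no-neighbours G R none | N-Q+N-R ca
      ... | eq | total rewrite eq | total = ≤-refl
      some-in-Q : ∀ r q → r + q ≡ 3 → 1 ≤ q → r + 0 ≤ 2 * q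
      some-in-Q zero q _ _ = z≤n
      some-in-Q (suc zero) q _ 1≤q = ≤-trans 1≤q (m≤m+n q _)
      some-in-Q (suc (suc zero)) q _ 1≤q = *-monoʳ-≤ 2 1≤q
      some-in-Q (suc (suc (suc zero))) zero _ ()
      at : ∀ a → N R a + (s a + a₀ a) ≤ 2 * N Q a
      at a with a ∈? S | a ∈? A₀
      ... | yes a∈S | yes a∈A₀ = contradiction a∈S (proj₁ (proj₂ (∈A₀⁻ a∈A₀)))
      ... | yes a∈S | no _ = all-in-Q (S⊆A a∈S) λ ab b∈R → proj₂ (∈R⁻ b∈R) (∈Q⁺ a∈S ab)
      ... | no _ | yes a∈A₀ =
        all-in-Q (proj₁ (∈A₀⁻ a∈A₀)) λ ab → proj₂ (proj₂ (∈A₀⁻ a∈A₀)) _ ab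
      ... | no _ | no _ with A? a
      ... | no a∉A = ≤-trans
        (≤-reflexive (cong (_+ 0) (no-neighbours G R λ ab b∈R → a∉A (to-A (proj₁ (∈R⁻ b∈R)) ab))))
        z≤n
      ... | yes ca with Q-neighbour ca
      ... | q , q∈ , aq = some-in-Q (N R a) (N Q a) (N-Q+N-R ca) (1≤neighbours G Q aq q∈)

    -- Otherwise the neighbours of `b` are `a`, `a′` and a vertex of `S`. By maximality of `M`, some
    -- neighbour of `b` in `A₀` is adjacent to `M`; it must be `a` or `a′`, yet `M` dominates
    -- neither.
    U-neighbour-unique : ∀ {b a a′} → b ∉ M → Adj G b a → a ∈ U → Adj G b a′ → a′ ∈ U → a ≡ a′
    U-neighbour-unique {b} {a} {a′} b∉M ba a∈U ba′ a′∈U with a ≟ᶠ a′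
    ... | yes eq = eq
    ... | no a≢a′ with ∈U⁻ a∈U | ∈U⁻ a′∈U
    ... | a∈A₀ , a-free | a′∈A₀ , a′-free
      with M-blocks (b∈Q , a , a′ , a≢a′ , (ba , a∈A₀) , (ba′ , a′∈A₀)) b∉M | ∈Q⁻ b∈Q
      where
      b∈Q : b ∈ Q
      b∈Q = A₀-to-Q a∈A₀ (Adj-sym G ba)
    ... | m , m∈M , _ , x , x∈A₀ , xb , xm | s , s∈S , sb
      with neighbours-among G cubic (Adj-sym G sb) ba ba′
             (λ { refl → proj₁ (proj₂ (∈A₀⁻ a∈A₀)) s∈S })
             (λ { refl → proj₁ (proj₂ (∈A₀⁻ a′∈A₀)) s∈S }) a≢a′ (Adj-sym G xb)
    ... | 1st = contradiction s∈S (proj₁ (proj₂ (∈A₀⁻ x∈A₀)))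
    ... | 2nd = contradiction (m , m∈M , Adj-sym G xm) a-free
    ... | 3rd = contradiction (m , m∈M , Adj-sym G xm) a′-free

    -- All three edges at a vertex of `U` end in `Q`. A vertex of `M` receives none of them, any
    -- other vertex of `Q` at most one.
    uncovered-count : 3 * ∣ U ∣ + ∣ M ∣ ≤ ∣ Q ∣
    uncovered-count = begin
      3 * ∣ U ∣ + ∣ M ∣
        ≡⟨ cong₂ _+_ (sym (sum-neighbours-in G cubic U)) (∣∣≡sum M) ⟩
      sum (N U) + sum (λ b → ⟦ b ∈? M ⟧)
        ≡⟨ ∑-distrib-+ (N U) (λ b → ⟦ b ∈? M ⟧) ⟨
      sum (λ b → N U b + ⟦ b ∈? M ⟧)
        ≤⟨ sum-mono at ⟩
      sum (λ b → ⟦ b ∈? Q ⟧)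
        ≡⟨ ∣∣≡sum Q ⟨
      ∣ Q ∣ ∎
      where
      open ≤-Reasoning
      at : ∀ b → N U b + ⟦ b ∈? M ⟧ ≤ ⟦ b ∈? Q ⟧
      at b with b ∈? M | b ∈? Q
      ... | yes b∈M | yes _ = ≤-reflexive
        (cong (_+ 1) (no-neighbours G U λ ba a∈U → proj₂ (∈U⁻ a∈U) (b , b∈M , ba)))
      ... | yes b∈M | no b∉Q = contradiction (proj₁ (∈M⁻ b∈M)) b∉Q
      ... | no b∉M | yes _ =
        ≤-trans (≤-reflexive (+-identityʳ (N U b))) (neighbours≤1 G U (U-neighbour-unique b∉M))
      ... | no _ | no b∉Q = ≤-reflexive (trans (+-identityʳ (N U b))
        (no-neighbours G U λ ba a∈U → b∉Q (A₀-to-Q (proj₁ (∈U⁻ a∈U)) (Adj-sym G ba))))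

    -- Every vertex of `M` has at least two neighbours in `A₀`; different vertices of `M` share none
    -- of these, and none lies in `U`.
    matched-count : ∣ U ∣ + 2 * ∣ M ∣ ≤ ∣ A₀ ∣
    matched-count = begin
      ∣ U ∣ + 2 * ∣ M ∣
        ≡⟨ cong₂ _+_ (∣∣≡sum U) (*∣∣≡sum 2 M) ⟩
      sum (λ a → ⟦ a ∈? U ⟧) + sum (λ b → 2 * ⟦ b ∈? M ⟧)
        ≤⟨ +-monoʳ-≤ (sum (λ a → ⟦ a ∈? U ⟧)) (sum-mono two-ends) ⟩
      sum (λ a → ⟦ a ∈? U ⟧) + sum (λ b → ⟦ b ∈? M ⟧ * N A₀ b)
        ≡⟨ cong (sum (λ a → ⟦ a ∈? U ⟧) +_) (edges-between G A₀ M) ⟨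
      sum (λ a → ⟦ a ∈? U ⟧) + sum (λ a → ⟦ a ∈? A₀ ⟧ * N M a)
        ≡⟨ ∑-distrib-+ (λ a → ⟦ a ∈? U ⟧) (λ a → ⟦ a ∈? A₀ ⟧ * N M a) ⟨
      sum (λ a → ⟦ a ∈? U ⟧ + ⟦ a ∈? A₀ ⟧ * N M a)
        ≤⟨ sum-mono at ⟩
      sum (λ a → ⟦ a ∈? A₀ ⟧)
        ≡⟨ ∣∣≡sum A₀ ⟨
      ∣ A₀ ∣ ∎
      where
      open ≤-Reasoning
      two-ends : ∀ b → 2 * ⟦ b ∈? M ⟧ ≤ ⟦ b ∈? M ⟧ * N A₀ b
      two-ends b with b ∈? M
      ... | no _ = z≤n
      ... | yes b∈M with ∈M⁻ b∈M
      ... | _ , a , a′ , a≢a′ , (ba , a∈) , (ba′ , a′∈) =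
        ≤-trans (2≤neighbours G A₀ a≢a′ ba a∈ ba′ a′∈) (≤-reflexive (sym (*-identityˡ _)))
      at : ∀ a → ⟦ a ∈? U ⟧ + ⟦ a ∈? A₀ ⟧ * N M a ≤ ⟦ a ∈? A₀ ⟧
      at a with a ∈? U | a ∈? A₀
      ... | yes a∈U | no a∉A₀ = contradiction (proj₁ (∈U⁻ a∈U)) a∉A₀
      ... | no _ | no _ = z≤n
      ... | yes a∈U | yes _ = ≤-reflexive (cong (λ k → 1 + 1 * k)
        (no-neighbours G M λ ab b∈M → proj₂ (∈U⁻ a∈U) (_ , b∈M , Adj-sym G ab)))
      ... | no _ | yes a∈A₀ = ≤-trans (≤-reflexive (*-identityˡ _)) (neighbours≤1 G M unique)
        where
        unique : ∀ {b b′} → Adj G a b → b ∈ M → Adj G a b′ → b′ ∈ M → b ≡ b′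
        unique {b} {b′} ab b∈ ab′ b′∈ with b ≟ᶠ b′
        ... | yes eq = eq
        ... | no b≢b′ = contradiction (b≢b′ , a , a∈A₀ , ab , ab′) (M-independent b b′ b∈ b′∈)

    -- The dominating set and the packing

    X = S ∪ D ∪ M ∪ U

    X-dominating : Dominating G X
    X-dominating v with A? v
    ... | yes cv with v ∈? S | any? (λ b → Adj? G v b ×-dec (b ∈? R)) | any? (λ b → (b ∈? M) ×-dec Adj? G b v)
    ... | yes v∈S | _ | _ = inj₁ (x∈p∪q⁺ (inj₁ v∈S))
    ... | no _ | yes (b , vb , b∈R) | _ =
      Dominated-⊆ G (λ x∈ → q⊆p∪q S _ (p⊆p∪q _ x∈)) (D-dominates-N b∈R vb)
    ... | no _ | no _ | yes (b , b∈M , bv) =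
      inj₂ (b , q⊆p∪q S _ (q⊆p∪q D _ (p⊆p∪q _ b∈M)) , bv)
    ... | no v∉S | no no-R | no no-M =
      inj₁ (q⊆p∪q S _ (q⊆p∪q D _ (q⊆p∪q M _ (∈U⁺
        (∈A₀⁺ cv v∉S λ b vb b∈R → no-R (b , vb , b∈R)) no-M))))
    X-dominating v | no v∉A with v ∈? Q
    ... | yes v∈Q with ∈Q⁻ v∈Q
    ... | a , a∈S , av = inj₂ (a , x∈p∪q⁺ (inj₁ a∈S) , av)
    X-dominating v | no v∉A | no v∉Q = Dominated-⊆ G (λ x∈ → q⊆p∪q S _ (p⊆p∪q _ x∈))
      (D-dominates-R (∈R⁺ (not-true v∉A) v∉Q))
      where
      not-true : ∀ {x} → x ≢ true → x ≡ false
      not-true {true} x≢ = contradiction refl x≢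
      not-true {false} _ = refl

    ∣X∣≤ : ∣ X ∣ ≤ ∣ S ∣ + ∣ D ∣ + ∣ M ∣ + ∣ U ∣
    ∣X∣≤ = begin
      ∣ X ∣                                  ≤⟨ ∣p∪q∣≤∣p∣+∣q∣ S _ ⟩
      ∣ S ∣ + ∣ D ∪ M ∪ U ∣                  ≤⟨ +-monoʳ-≤ ∣ S ∣ (∣p∪q∣≤∣p∣+∣q∣ D _) ⟩
      ∣ S ∣ + (∣ D ∣ + ∣ M ∪ U ∣)            ≤⟨ +-monoʳ-≤ ∣ S ∣ (+-monoʳ-≤ ∣ D ∣ (∣p∪q∣≤∣p∣+∣q∣ M U)) ⟩
      ∣ S ∣ + (∣ D ∣ + (∣ M ∣ + ∣ U ∣))      ≡⟨ +-assoc ∣ S ∣ ∣ D ∣ _ ⟨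
      ∣ S ∣ + ∣ D ∣ + (∣ M ∣ + ∣ U ∣)        ≡⟨ +-assoc (∣ S ∣ + ∣ D ∣) ∣ M ∣ ∣ U ∣ ⟨
      ∣ S ∣ + ∣ D ∣ + ∣ M ∣ + ∣ U ∣          ∎
      where open ≤-Reasoning

    Y = S ∪ I

    I⊆R : I ⊆ R
    I⊆R = proj₁ I-independent

    -- The colours rule out a common vertex or a common neighbour, and an edge from `a` to `b` would
    -- put `b` into `Q`.
    across : ∀ {a b w} → a ∈ S → b ∈ I → ¬ (InClosedNbhd G a w × InClosedNbhd G b w)
    across a∈ b∈ (inj₁ refl , inj₁ refl) = true≢false (S⊆A a∈) (proj₁ (∈R⁻ (I⊆R b∈)))
    across a∈ b∈ (inj₁ refl , inj₂ ba) = proj₂ (∈R⁻ (I⊆R b∈)) (∈Q⁺ a∈ (Adj-sym G ba))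
    across a∈ b∈ (inj₂ ab , inj₁ refl) = proj₂ (∈R⁻ (I⊆R b∈)) (∈Q⁺ a∈ ab)
    across a∈ b∈ (inj₂ aw , inj₂ bw) =
      true≢false (to-A (to-B (S⊆A a∈) aw) bw) (proj₁ (∈R⁻ (I⊆R b∈)))

    within : ∀ {u v w} → colour u ≡ colour v → u ≢ v → ¬ SimpleGraph.E (conflict G ⊤) u v →
      ¬ (InClosedNbhd G u w × InClosedNbhd G v w)
    within cu≡cv u≢v free (inj₁ refl , inj₁ refl) = u≢v refl
    within cu≡cv u≢v free (inj₁ refl , inj₂ vu) = same-colour (sym cu≡cv) vu
    within cu≡cv u≢v free (inj₂ uv , inj₁ refl) = same-colour cu≡cv uv
    within cu≡cv u≢v free (inj₂ uw , inj₂ vw) = free (u≢v , _ , ∈⊤ , Adj-sym G uw , Adj-sym G vw)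

    Y-packing : Packing G Y
    Y-packing u v u∈ v∈ u≢v w both with x∈p∪q⁻ S I u∈ | x∈p∪q⁻ S I v∈
    ... | inj₁ u∈S | inj₁ v∈S = within (trans (S⊆A u∈S) (sym (S⊆A v∈S))) u≢v
      (S-independent u v u∈S v∈S) both
    ... | inj₁ u∈S | inj₂ v∈I = across u∈S v∈I both
    ... | inj₂ u∈I | inj₁ v∈S = across v∈S u∈I (proj₂ both , proj₁ both)
    ... | inj₂ u∈I | inj₂ v∈I =
      within (trans (proj₁ (∈R⁻ (I⊆R u∈I))) (sym (proj₁ (∈R⁻ (I⊆R v∈I))))) u≢v
        (proj₂ I-independent u v u∈I v∈I) both

    S+I≤Y : ∣ S ∣ + ∣ I ∣ ≤ ∣ Y ∣
    S+I≤Y = ∣p∣+∣q∣≤∣p∪q∣ S I λ v∈S v∈I → true≢false (S⊆A v∈S) (proj₁ (∈R⁻ (I⊆R v∈I)))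

  abstract
    domination-versus-packing : ∃ λ X → ∃ λ Y → Dominating G X × Packing G Y × 5 * ∣ X ∣ ≤ 12 * ∣ Y ∣
    domination-versus-packing = X , Y , X-dominating , Y-packing , (begin
      5 * ∣ X ∣                                ≤⟨ *-monoʳ-≤ 5 ∣X∣≤ ⟩
      5 * (∣ S ∣ + ∣ D ∣ + ∣ M ∣ + ∣ U ∣)      ≤⟨ cost-bound (∣ S ∣) (∣ D ∣) (∣ R ∣) (∣ I ∣) (∣ Q ∣) (∣ A₀ ∣) (∣ M ∣) (∣ U ∣)
                                                    D≤R D≤3I Q≤3S edge-count uncovered-count matched-count ⟩
      12 * (∣ S ∣ + ∣ I ∣)                     ≤⟨ *-monoʳ-≤ 12 S+I≤Y ⟩
      12 * ∣ Y ∣                               ∎)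
      where open ≤-Reasoning

theorem5 : ∀ {n : ℕ} (G : Graph n) → 1 ≤ n → Connected G → Bipartite G → Cubic G →
    ∀ (X Y : Subset n) → IsMinDominating G X → IsMaxPacking G Y →
    (49 * ∣ X ∣ ≤ 120 * ∣ Y ∣) × (100 * ∣ X ∣ < 245 * ∣ Y ∣)
theorem5 {n = suc n} G _ _ bipartite cubic X Y (_ , X-minimum) (_ , Y-maximum) =
  *-cancelˡ-≤ 5 (begin
    5 * (49 * ∣ X ∣)       ≡⟨ *-assoc 5 49 ∣ X ∣ ⟨
    245 * ∣ X ∣            ≡⟨ *-assoc 49 5 ∣ X ∣ ⟩
    49 * (5 * ∣ X ∣)       ≤⟨ *-monoʳ-≤ 49 5X≤12Y ⟩
    49 * (12 * ∣ Y ∣)      ≡⟨ *-assoc 49 12 ∣ Y ∣ ⟨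
    -- The slack between 12/5 and 120/49: 588 = 49 · 12 against 600 = 5 · 120.
    588 * ∣ Y ∣            ≤⟨ *-monoˡ-≤ ∣ Y ∣ (m≤m+n 588 12) ⟩
    600 * ∣ Y ∣            ≡⟨ *-assoc 5 120 ∣ Y ∣ ⟩
    5 * (120 * ∣ Y ∣)      ∎) ,
  (begin-strict
    100 * ∣ X ∣            ≡⟨ *-assoc 20 5 ∣ X ∣ ⟩
    20 * (5 * ∣ X ∣)       ≤⟨ *-monoʳ-≤ 20 5X≤12Y ⟩
    20 * (12 * ∣ Y ∣)      ≡⟨ *-assoc 20 12 ∣ Y ∣ ⟨
    -- Strictness needs a nonempty `Y`, which holds because a single vertex is a packing.
    240 * ∣ Y ∣            <⟨ *-monoˡ-< ∣ Y ∣ ⦃ >-nonZero 1≤Y ⦄ (m≤m+n 241 4) ⟩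
    245 * ∣ Y ∣            ∎)
  where
  open ≤-Reasoning
  5X≤12Y : 5 * ∣ X ∣ ≤ 12 * ∣ Y ∣
  5X≤12Y with domination-versus-packing G bipartite cubic
  ... | X′ , Y′ , dominating , packing , bound = ≤-trans (*-monoʳ-≤ 5 (X-minimum X′ dominating))
    (≤-trans bound (*-monoʳ-≤ 12 (Y-maximum Y′ packing)))
  1≤Y : 1 ≤ ∣ Y ∣
  1≤Y = ≤-trans (≤-reflexive (sym (∣⁅x⁆∣≡1 {suc n} zero)))
    (Y-maximum ⁅ zero ⁆ λ u v u∈ v∈ u≢v → contradiction
      (trans (x∈⁅y⁆⇒x≡y zero u∈) (sym (x∈⁅y⁆⇒x≡y zero v∈))) u≢v)
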